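{- For every positive integer $k$ there exists $c_k>0$ such that every graph $G$ on $n\geq 2$ vertices that contains neither the path $P_k$ nor its complement $\overline{P_k}$ as an induced subgraph contains two disjoint vertex sets $X,Y$, each of size at least $c_k\cdot n$, such that either every vertex of $X$ is adjacent to every vertex of $Y$, or no vertex of $X$ is adjacent to any vertex of $Y$ (no condition is imposed on edges inside $X$ or inside $Y$). Consequently, for every $k$ there exists $c'_k>0$ such that every graph on $n$ vertices with no induced $P_k$ and no induced $\overline{P_k}$ contains a clique or a stable set of size at least $n^{c'_k}$.
   Context: All graphs are finite and simple. $P_k$ denotes the path on $k$ vertices and $\overline{P_k}$ its complement graph. "Contains $H$ as an induced subgraph" means some subset of vertices induces a graph isomorphic to $H$. -}

module Defs where

open import Data.Fin using (Fin; toℕ)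
import Data.Fin.Properties as Fin
open import Data.Fin.Subset using (Subset; _∈_; _∩_; Empty)
open import Data.Integer as ℤ using (+_)
open import Data.Nat as ℕ using (ℕ; suc)
import Data.Nat.Properties as ℕ
open import Data.Product using (Σ; ∃; _×_; _,_; proj₁)
open import Data.Rational as ℚ using (ℚ; ↥_; ↧ₙ_)
open import Data.Sum using (_⊎_; inj₁; inj₂; swap)
open import Function.Base using (_on_; _∘_)
open import Function.Bundles using (_↔_; _⇔_; Inverse)
open import Level using (0ℓ)
open import Relation.Binary using (Rel; Symmetric; Irreflexive; Decidable)
open import Relation.Binary.PropositionalEquality using (_≡_; _≢_; refl; sym)
open import Relation.Nullary using (¬_)
open import Relation.Nullary.Decidable using (¬?; _×-dec_; _⊎-dec_)

record Graph (V : Set) : Set₁ where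
  field
    Adj        : Rel V 0ℓ
    adj?       : Decidable Adj
    adj-sym    : Symmetric Adj
    adj-irrefl : Irreflexive _≡_ Adj

open Graph public using (Adj)

path : (k : ℕ) → Graph (Fin k)
path k = record
  { Adj        = λ i j → suc (toℕ i) ≡ toℕ j ⊎ suc (toℕ j) ≡ toℕ i
  ; adj?       = λ i j → (suc (toℕ i) ℕ.≟ toℕ j) ⊎-dec (suc (toℕ j) ℕ.≟ toℕ i)
  ; adj-sym    = swap
  ; adj-irrefl = λ { refl (inj₁ e) → ℕ.1+n≢n e ; refl (inj₂ e) → ℕ.1+n≢n e }
  }

complement : ∀ {n} → Graph (Fin n) → Graph (Fin n)
complement G = record
  { Adj        = λ u v → u ≢ v × ¬ Adj G u v
  ; adj?       = λ u v → ¬? (u Fin.≟ v) ×-dec ¬? (Graph.adj? G u v)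
  ; adj-sym    = λ (u≢v , ¬uv) → u≢v ∘ sym , ¬uv ∘ Graph.adj-sym G
  ; adj-irrefl = λ u≡v (u≢v , _) → u≢v u≡v
  }

induced : ∀ {n} → Graph (Fin n) → (S : Subset n) → Graph (∃ (_∈ S))
induced G S = record
  { Adj        = Adj G on proj₁
  ; adj?       = λ u v → Graph.adj? G (proj₁ u) (proj₁ v)
  ; adj-sym    = Graph.adj-sym G
  ; adj-irrefl = λ { refl → Graph.adj-irrefl G refl }
  }

_≅_ : ∀ {V W} → Graph V → Graph W → Set
_≅_ {V} {W} G H =
  Σ (V ↔ W) λ φ → ∀ u v → Adj G u v ⇔ Adj H (Inverse.to φ u) (Inverse.to φ v)

ContainsInduced : ∀ {n k} → Graph (Fin n) → Graph (Fin k) → Set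
ContainsInduced {n} G H = Σ (Subset n) λ S → induced G S ≅ H

module _ {n} (G : Graph (Fin n)) where

  Complete : Subset n → Subset n → Set
  Complete X Y = ∀ {x y} → x ∈ X → y ∈ Y → Adj G x y

  Anticomplete : Subset n → Subset n → Set
  Anticomplete X Y = ∀ {x y} → x ∈ X → y ∈ Y → ¬ Adj G x y

  Clique : Subset n → Set
  Clique S = ∀ {u v} → u ∈ S → v ∈ S → u ≢ v → Adj G u v

  Stable : Subset n → Set
  Stable S = ∀ {u v} → u ∈ S → v ∈ S → ¬ Adj G u v

Disjoint : ∀ {n} → Subset n → Subset n → Set
Disjoint X Y = Empty (X ∩ Y)

fromℕ : ℕ → ℚ
fromℕ n = + n ℚ./ 1

-- n ^ c ≤ s for a rational exponent c = p / q > 0, i.e. n ^ p ≤ s ^ q.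
-- The numerator enters through its absolute value, so this is meaningful
-- only for c ≥ 0.
Power≤ : ℕ → ℚ → ℕ → Set
Power≤ n c s = n ℕ.^ ℤ.∣ ↥ c ∣ ℕ.≤ s ℕ.^ ↧ₙ c

{-# OPTIONS --safe #-}

-- Greedy embedding of P_k into k disjoint parts of linear size fails only if some pair of large
-- sets A, B is nearly empty or nearly complete to each other; double counting makes this
-- hold from both sides.  Nesting such pairs (the constants of the inner ones being chosen first)
-- gives many sets of equal size, pairwise sparse in G or pairwise sparse in its complement.  In
-- their union all degrees are a small fraction of the size, whatever happens inside each set.  In
-- such a sparse graph without a large anticomplete pair, every large vertex set has a component
-- missing only few vertices, and repeatedly deleting the closed neighbourhood of the last vertex
-- of an induced path and passing to this component extends the path to k vertices.
-- For the second part, pure pairs are iterated on the maximum of ∣K∣ ∣I∣ over cliques K and stable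
-- sets I: this product is superadditive over pure pairs.

module Submission where

open import Data.Bool using (Bool; true; false)
open import Data.Empty using (⊥-elim)
open import Data.Fin as Fin using (Fin; zero; suc)
import Data.Fin.Properties as Fin
open import Data.Fin.Subset
open import Data.Fin.Subset.Properties
import Data.Integer as ℤ
import Data.Integer.Properties as ℤ
open import Data.Nat using (ℕ; zero; suc; pred; _+_; _*_; _^_; _≤_; _<_; z≤n; s≤s; NonZero; >-nonZero)
open import Data.Nat.Coprimality using (1-coprimeTo)
open import Data.Nat.DivMod using (_/_; _%_; m≡m%n+[m/n]*n; m%n≤n; m/n*n≤m; m≥n⇒m/n>0)
open import Data.Nat.Properties hiding (_≟_)
open import Data.Nat.Tactic.RingSolver using (solve-∀)
open import Data.Product using (Σ; ∃; ∃-syntax; _×_; _,_; proj₁; proj₂)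
open import Data.Rational as ℚ using (ℚ; 0ℚ; mkℚ; toℚᵘ)
import Data.Rational.Properties as ℚ
open import Data.Rational.Unnormalised as ℚᵘ using (mkℚᵘ)
import Data.Rational.Unnormalised.Properties as ℚᵘ
open import Data.Sum using (_⊎_; inj₁; inj₂; [_,_]′)
open import Data.Vec using ([]; _∷_; here; there; tabulate)
open import Data.Vec.Properties using (lookup⇒[]=; []=⇒lookup; lookup∘tabulate)
open import Data.Vec.Properties.WithK using ([]=-irrelevant)
open import Function using (_∘_; id)
open import Function.Bundles using (mk⇔; mk↔ₛ′)
open import Relation.Binary.Definitions using (tri<; tri≈; tri>)
open import Relation.Binary.PropositionalEquality
open import Relation.Nullary using (¬_; Dec; yes; no; does; contradiction)
open import Relation.Nullary.Decidable using (_×-dec_; dec-true; decidable-stable)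
open import Relation.Unary using (Decidable)
open import Defs

private
  variable
    n : ℕ

-- Finite sets

filter : {P : Fin n → Set} → Decidable P → Subset n
filter P? = tabulate (does ∘ P?)

∈-filter⁺ : {P : Fin n → Set} (P? : Decidable P) {x : Fin n} → P x → x ∈ filter P?
∈-filter⁺ P? {x} px =
  lookup⇒[]= x _ (trans (lookup∘tabulate (does ∘ P?) x) (dec-true (P? x) px))

∈-filter⁻ : {P : Fin n → Set} (P? : Decidable P) {x : Fin n} → x ∈ filter P? → P x
∈-filter⁻ P? {x} x∈ with P? x | trans (sym (lookup∘tabulate (does ∘ P?) x)) ([]=⇒lookup x∈)
... | yes px | _  = px
... | no _   | ()

x∈p─q⇒x∉q : (p q : Subset n) {x : Fin n} → x ∈ p ─ q → x ∉ q
x∈p─q⇒x∉q (_ ∷ p) (_ ∷ q) (there x∈) (there x∈q) = x∈p─q⇒x∉q p q x∈ x∈q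

∣p∣≡∣p∩q∣+∣p─q∣ : (p q : Subset n) → ∣ p ∣ ≡ ∣ p ∩ q ∣ + ∣ p ─ q ∣
∣p∣≡∣p∩q∣+∣p─q∣ [] [] = refl
∣p∣≡∣p∩q∣+∣p─q∣ (true ∷ p) (true ∷ q) = cong suc (∣p∣≡∣p∩q∣+∣p─q∣ p q)
∣p∣≡∣p∩q∣+∣p─q∣ (true ∷ p) (false ∷ q) =
  trans (cong suc (∣p∣≡∣p∩q∣+∣p─q∣ p q)) (sym (+-suc ∣ p ∩ q ∣ _))
∣p∣≡∣p∩q∣+∣p─q∣ (false ∷ p) (true ∷ q) = ∣p∣≡∣p∩q∣+∣p─q∣ p q
∣p∣≡∣p∩q∣+∣p─q∣ (false ∷ p) (false ∷ q) = ∣p∣≡∣p∩q∣+∣p─q∣ p q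

∣p∣≤∣q∣+∣p─q∣ : (p q : Subset n) → ∣ p ∣ ≤ ∣ q ∣ + ∣ p ─ q ∣
∣p∣≤∣q∣+∣p─q∣ p q = begin
  ∣ p ∣                    ≡⟨ ∣p∣≡∣p∩q∣+∣p─q∣ p q ⟩
  ∣ p ∩ q ∣ + ∣ p ─ q ∣    ≤⟨ +-monoˡ-≤ _ (∣p∩q∣≤∣q∣ p q) ⟩
  ∣ q ∣ + ∣ p ─ q ∣        ∎
  where open ≤-Reasoning

∣p∪q∣≤∣p∣+∣q∣ : (p q : Subset n) → ∣ p ∪ q ∣ ≤ ∣ p ∣ + ∣ q ∣
∣p∪q∣≤∣p∣+∣q∣ p q = begin
  ∣ p ∪ q ∣                 ≤⟨ ∣p∣≤∣q∣+∣p─q∣ (p ∪ q) p ⟩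
  ∣ p ∣ + ∣ (p ∪ q) ─ p ∣   ≤⟨ +-monoʳ-≤ ∣ p ∣ (p⊆q⇒∣p∣≤∣q∣ sub) ⟩
  ∣ p ∣ + ∣ q ∣             ∎
  where
  open ≤-Reasoning
  sub : (p ∪ q) ─ p ⊆ q
  sub x∈ with x∈p∪q⁻ p q (p─q⊆p (p ∪ q) p x∈)
  ... | inj₁ x∈p = contradiction x∈p (x∈p─q⇒x∉q (p ∪ q) p x∈)
  ... | inj₂ x∈q = x∈q

infix 4 _#_

_#_ : Subset n → Subset n → Set
p # q = ∀ {x} → x ∈ p → x ∉ q

#⇒Disjoint : {p q : Subset n} → p # q → Disjoint p q
#⇒Disjoint {p = p} {q} p#q (x , x∈) = p#q (proj₁ (x∈p∩q⁻ p q x∈)) (proj₂ (x∈p∩q⁻ p q x∈))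

∣p∪q∣≡∣p∣+∣q∣ : (p q : Subset n) → p # q → ∣ p ∪ q ∣ ≡ ∣ p ∣ + ∣ q ∣
∣p∪q∣≡∣p∣+∣q∣ p q p#q = ≤-antisym (∣p∪q∣≤∣p∣+∣q∣ p q) (begin
  ∣ p ∣ + ∣ q ∣                         ≤⟨ +-mono-≤ (p⊆q⇒∣p∣≤∣q∣ left) (p⊆q⇒∣p∣≤∣q∣ right) ⟩
  ∣ (p ∪ q) ∩ p ∣ + ∣ (p ∪ q) ─ p ∣     ≡⟨ ∣p∣≡∣p∩q∣+∣p─q∣ (p ∪ q) p ⟨
  ∣ p ∪ q ∣                             ∎)
  where
  open ≤-Reasoning
  left : p ⊆ (p ∪ q) ∩ p
  left x∈p = x∈p∩q⁺ (x∈p∪q⁺ (inj₁ x∈p) , x∈p)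
  right : q ⊆ (p ∪ q) ─ p
  right x∈q = x∈p∧x∉q⇒x∈p─q (x∈p∪q⁺ (inj₂ x∈q)) λ x∈p → p#q x∈p x∈q

nonempty-of-pos : (p : Subset n) → 1 ≤ ∣ p ∣ → Nonempty p
nonempty-of-pos (true ∷ p)  _ = zero , here
nonempty-of-pos (false ∷ p) h with nonempty-of-pos p h
... | x , x∈p = suc x , there x∈p

trim : (p : Subset n) (m : ℕ) → m ≤ ∣ p ∣ → ∃[ q ] q ⊆ p × ∣ q ∣ ≡ m
trim {n} p zero _ = ⊥ , ⊥⊆ , ∣⊥∣≡0 n
trim (true ∷ p) (suc m) (s≤s h) with trim p m h
... | q , q⊆p , eq = true ∷ q , in⊆in q⊆p , cong suc eq
trim (false ∷ p) (suc m) h with trim p (suc m) h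
... | q , q⊆p , eq = false ∷ q , out⊆ q⊆p , eq

pigeonhole : ∀ k (P : Fin k → Subset n) (p : Subset n) (m : ℕ) → k * m < ∣ p ∣ →
  (∀ {x} → x ∈ p → ∃[ j ] x ∈ P j) → ∃[ j ] m < ∣ p ∩ P j ∣
pigeonhole zero P p m h cover with cover (proj₂ (nonempty-of-pos p h))
... | () , _
pigeonhole (suc k) P p m h cover with m <? ∣ p ∩ P zero ∣
... | yes big = zero , big
... | no ¬big with pigeonhole k (P ∘ suc) (p ─ P zero) m small cover′
  where
  small : k * m < ∣ p ─ P zero ∣
  small = +-cancelˡ-< m _ _ (begin-strict
    m + k * m                                ≡⟨⟩
    suc k * m                                <⟨ h ⟩
    ∣ p ∣                                    ≡⟨ ∣p∣≡∣p∩q∣+∣p─q∣ p (P zero) ⟩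
    ∣ p ∩ P zero ∣ + ∣ p ─ P zero ∣          ≤⟨ +-monoˡ-≤ _ (≮⇒≥ ¬big) ⟩
    m + ∣ p ─ P zero ∣                       ∎)
    where open ≤-Reasoning
  cover′ : ∀ {x} → x ∈ p ─ P zero → ∃[ j ] x ∈ P (suc j)
  cover′ x∈ with cover (p─q⊆p p (P zero) x∈)
  ... | zero  , x∈P = contradiction x∈P (x∈p─q⇒x∉q p (P zero) x∈)
  ... | suc j , x∈P = j , x∈P
... | j , big = suc j , <-≤-trans big (p⊆q⇒∣p∣≤∣q∣ λ x∈ →
        let x∈p─P₀ , x∈P = x∈p∩q⁻ (p ─ P zero) (P (suc j)) x∈ in x∈p∩q⁺ (p─q⊆p p (P zero) x∈p─P₀ , x∈P))

disjointParts : ∀ k m (p : Subset n) → k * m ≤ ∣ p ∣ →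
  Σ (Fin k → Subset n) λ B → (∀ i → B i ⊆ p) × (∀ i → m ≤ ∣ B i ∣) × (∀ i j → i ≢ j → B i # B j)
disjointParts zero m p h = (λ ()) , (λ ()) , (λ ()) , λ ()
disjointParts (suc k) m p h with trim p m (≤-trans (m≤m+n m (k * m)) h)
... | q , q⊆p , ∣q∣≡m with disjointParts k m (p ─ q) rest
  where
  rest : k * m ≤ ∣ p ─ q ∣
  rest = +-cancelˡ-≤ m _ _ (begin
    m + k * m            ≤⟨ h ⟩
    ∣ p ∣                ≤⟨ ∣p∣≤∣q∣+∣p─q∣ p q ⟩
    ∣ q ∣ + ∣ p ─ q ∣    ≡⟨ cong (_+ ∣ p ─ q ∣) ∣q∣≡m ⟩
    m + ∣ p ─ q ∣        ∎)
    where open ≤-Reasoning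
... | B , B⊆ , big , disj = B′ , B′⊆ , big′ , disj′
  where
  B′ : Fin (suc k) → Subset _
  B′ zero    = q
  B′ (suc i) = B i
  B′⊆ : ∀ i → B′ i ⊆ p
  B′⊆ zero    x∈ = q⊆p x∈
  B′⊆ (suc i) x∈ = p─q⊆p p q (B⊆ i x∈)
  big′ : ∀ i → m ≤ ∣ B′ i ∣
  big′ zero    = ≤-reflexive (sym ∣q∣≡m)
  big′ (suc i) = big i
  disj′ : ∀ i j → i ≢ j → B′ i # B′ j
  disj′ zero    zero    i≢j = contradiction refl i≢j
  disj′ zero    (suc j) _ x∈q x∈B = x∈p─q⇒x∉q p q (B⊆ j x∈B) x∈q
  disj′ (suc i) zero    _ x∈B x∈q = x∈p─q⇒x∉q p q (B⊆ i x∈B) x∈q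
  disj′ (suc i) (suc j) i≢j = disj i j (i≢j ∘ cong suc)

-- Degrees and double counting

sumOver : Subset n → (Fin n → ℕ) → ℕ
sumOver []          f = 0
sumOver (true ∷ p)  f = f zero + sumOver p (f ∘ suc)
sumOver (false ∷ p) f = sumOver p (f ∘ suc)

sumOver-cong : (p : Subset n) {f g : Fin n → ℕ} → (∀ x → f x ≡ g x) → sumOver p f ≡ sumOver p g
sumOver-cong []          f≗g = refl
sumOver-cong (true ∷ p)  f≗g = cong₂ _+_ (f≗g zero) (sumOver-cong p (f≗g ∘ suc))
sumOver-cong (false ∷ p) f≗g = sumOver-cong p (f≗g ∘ suc)

sumOver-0 : (p : Subset n) → sumOver p (λ _ → 0) ≡ 0
sumOver-0 []          = refl
sumOver-0 (true ∷ p)  = sumOver-0 p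
sumOver-0 (false ∷ p) = sumOver-0 p

sumOver-+ : (p : Subset n) (f g : Fin n → ℕ) →
  sumOver p (λ x → f x + g x) ≡ sumOver p f + sumOver p g
sumOver-+ []          f g = refl
sumOver-+ (false ∷ p) f g = sumOver-+ p (f ∘ suc) (g ∘ suc)
sumOver-+ (true ∷ p)  f g =
  trans (cong (f zero + g zero +_) (sumOver-+ p (f ∘ suc) (g ∘ suc)))
        (interchange (f zero) (g zero) _ _)
  where
  interchange : ∀ a b c d → a + b + (c + d) ≡ a + c + (b + d)
  interchange = solve-∀

sumOver-swap : ∀ {m} (p : Subset m) (q : Subset n) (f : Fin m → Fin n → ℕ) →
  sumOver p (λ x → sumOver q (f x)) ≡ sumOver q (λ y → sumOver p (λ x → f x y))
sumOver-swap []          q f = sym (sumOver-0 q)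
sumOver-swap (false ∷ p) q f = sumOver-swap p q (f ∘ suc)
sumOver-swap (true ∷ p)  q f =
  trans (cong (sumOver q (f zero) +_) (sumOver-swap p q (f ∘ suc)))
        (sym (sumOver-+ q (f zero) _))

sumOver-≤ : (p : Subset n) (f : Fin n → ℕ) (s : ℕ) →
  (∀ {x} → x ∈ p → f x ≤ s) → sumOver p f ≤ ∣ p ∣ * s
sumOver-≤ []          f s h = z≤n
sumOver-≤ (true ∷ p)  f s h = +-mono-≤ (h here) (sumOver-≤ p (f ∘ suc) s (h ∘ there))
sumOver-≤ (false ∷ p) f s h = sumOver-≤ p (f ∘ suc) s (h ∘ there)

sumOver-≥ : (p : Subset n) (f : Fin n → ℕ) (s : ℕ) →
  (∀ {x} → x ∈ p → s ≤ f x) → ∣ p ∣ * s ≤ sumOver p f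
sumOver-≥ []          f s h = z≤n
sumOver-≥ (true ∷ p)  f s h = +-mono-≤ (h here) (sumOver-≥ p (f ∘ suc) s (h ∘ there))
sumOver-≥ (false ∷ p) f s h = sumOver-≥ p (f ∘ suc) s (h ∘ there)

indicator : {A : Set} → Dec A → ℕ
indicator (yes _) = 1
indicator (no _)  = 0

indicator-⇔ : {A B : Set} (a? : Dec A) (b? : Dec B) → (A → B) → (B → A) →
  indicator a? ≡ indicator b?
indicator-⇔ (yes _) (yes _) _ _ = refl
indicator-⇔ (no _)  (no _)  _ _ = refl
indicator-⇔ (yes a) (no ¬b) f _ = contradiction (f a) ¬b
indicator-⇔ (no ¬a) (yes b) _ g = contradiction (g b) ¬a

∣filter∩p∣≡sumOver : {P : Fin n → Set} (P? : Decidable P) (p : Subset n) →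
  ∣ filter P? ∩ p ∣ ≡ sumOver p (indicator ∘ P?)
∣filter∩p∣≡sumOver P? [] = refl
∣filter∩p∣≡sumOver P? (true ∷ p) with P? zero
... | yes _ = cong suc (∣filter∩p∣≡sumOver (P? ∘ suc) p)
... | no _  = ∣filter∩p∣≡sumOver (P? ∘ suc) p
∣filter∩p∣≡sumOver P? (false ∷ p) with P? zero
... | yes _ = ∣filter∩p∣≡sumOver (P? ∘ suc) p
... | no _  = ∣filter∩p∣≡sumOver (P? ∘ suc) p

nbrs : Graph (Fin n) → Fin n → Subset n
nbrs G v = filter (Graph.adj? G v)

deg : Graph (Fin n) → Fin n → Subset n → ℕ
deg G v p = ∣ nbrs G v ∩ p ∣

deg-mono : (G : Graph (Fin n)) (v : Fin n) {p q : Subset n} → p ⊆ q → deg G v p ≤ deg G v q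
deg-mono G v {p} {q} p⊆q = p⊆q⇒∣p∣≤∣q∣ λ x∈ →
  let x∈N , x∈p = x∈p∩q⁻ (nbrs G v) p x∈ in x∈p∩q⁺ (x∈N , p⊆q x∈p)

deg-∪ : (G : Graph (Fin n)) (v : Fin n) (p q : Subset n) → deg G v (p ∪ q) ≤ deg G v p + deg G v q
deg-∪ G v p q = ≤-trans (p⊆q⇒∣p∣≤∣q∣ sub) (∣p∪q∣≤∣p∣+∣q∣ (nbrs G v ∩ p) (nbrs G v ∩ q))
  where
  sub : nbrs G v ∩ (p ∪ q) ⊆ (nbrs G v ∩ p) ∪ (nbrs G v ∩ q)
  sub x∈ with x∈p∩q⁻ (nbrs G v) (p ∪ q) x∈
  ... | x∈N , x∈∪ with x∈p∪q⁻ p q x∈∪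
  ...   | inj₁ x∈p = x∈p∪q⁺ (inj₁ (x∈p∩q⁺ (x∈N , x∈p)))
  ...   | inj₂ x∈q = x∈p∪q⁺ (inj₂ (x∈p∩q⁺ (x∈N , x∈q)))

deg-swap : (G : Graph (Fin n)) (p q : Subset n) →
  sumOver p (λ x → deg G x q) ≡ sumOver q (λ y → deg G y p)
deg-swap G p q = begin
  sumOver p (λ x → deg G x q)
    ≡⟨ sumOver-cong p (λ x → ∣filter∩p∣≡sumOver (adj? x) q) ⟩
  sumOver p (λ x → sumOver q (λ y → indicator (adj? x y)))
    ≡⟨ sumOver-swap p q _ ⟩
  sumOver q (λ y → sumOver p (λ x → indicator (adj? x y)))
    ≡⟨ sumOver-cong q (λ y → sumOver-cong p (λ x → indicator-⇔ (adj? x y) (adj? y x) adj-sym adj-sym)) ⟩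
  sumOver q (λ y → sumOver p (λ x → indicator (adj? y x)))
    ≡⟨ sumOver-cong q (λ y → ∣filter∩p∣≡sumOver (adj? y) p) ⟨
  sumOver q (λ y → deg G y p) ∎
  where
  open ≡-Reasoning
  open Graph G using (adj?; adj-sym)

-- Both sides bound the number of edges between `p` and `q`, counted from `q` and from `p`.
doubleCount : (G : Graph (Fin n)) (p q : Subset n) (r s : ℕ) →
  (∀ {x} → x ∈ p → deg G x q ≤ s) → (∀ {y} → y ∈ q → r ≤ deg G y p) →
  ∣ q ∣ * r ≤ ∣ p ∣ * s
doubleCount G p q r s upper lower = begin
  ∣ q ∣ * r                     ≤⟨ sumOver-≥ q _ r lower ⟩
  sumOver q (λ y → deg G y p)   ≡⟨ deg-swap G p q ⟨
  sumOver p (λ x → deg G x q)   ≤⟨ sumOver-≤ p _ s upper ⟩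
  ∣ p ∣ * s                     ∎
  where open ≤-Reasoning

-- Sparse pairs and sparse sets

colour : Graph (Fin n) → Bool → Graph (Fin n)
colour G true  = G
colour G false = complement G

-- Density at most `1 / e` in integers: sizes are at least `e` times the degree bound `s`. The scale
-- `s` is only found during the search, and `t` and `T` keep it within a constant factor of the
-- scale asked for.
record LowPair (G : Graph (Fin n)) (W : Subset n) (e t T : ℕ) : Set where
  field
    s     : ℕ
    t≤s   : t ≤ s
    s≤T   : s ≤ T
    A B   : Subset n
    A⊆W   : A ⊆ W
    B⊆W   : B ⊆ W
    A#B   : A # B
    ∣A∣≥  : e * s ≤ ∣ A ∣
    ∣B∣≥  : e * s ≤ ∣ B ∣
    low   : ∀ {a} → a ∈ A → deg G a B ≤ s

LowPair-weaken : {G : Graph (Fin n)} {W : Subset n} {e t T T′ : ℕ} → T ≤ T′ →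
  LowPair G W e t T → LowPair G W e t T′
LowPair-weaken T≤T′ P = record { LowPair P ; s≤T = ≤-trans (LowPair.s≤T P) T≤T′ }

-- Both colours are irreflexive, since adjacency in `complement` includes distinctness. Hence such
-- an `f` is injective, and by symmetry the pairs with `i` below `j` determine all adjacencies.
Embeds : ∀ {k} → Graph (Fin n) → (Fin k → Fin k → Bool) → (Fin k → Fin n) → Set
Embeds G h f = ∀ i j → i Fin.< j → Adj (colour G (h i j)) (f i) (f j)

-- With `s = embedConst e k * t`, each part must have `s + e * s + k * (e * s)` vertices: the last
-- term feeds the pigeonhole over the remaining `k` parts, `e * s` is the size required of the
-- second set of a low pair, and the extra `s` makes the pigeonhole strict and keeps `s` below the
-- new bound.
embedConst : ℕ → ℕ → ℕ
embedConst e zero    = 1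
embedConst e (suc k) = (1 + e + k * e) * embedConst e k

1≤embedConst : ∀ e k → 1 ≤ embedConst e k
1≤embedConst e zero    = ≤-refl
1≤embedConst e (suc k) = ≤-trans (1≤embedConst e k) (m≤m+n _ ((e + k * e) * embedConst e k))

-- Induction on the number of parts. A vertex of `B zero` is usable if it has at least `s`
-- neighbours of the prescribed colour in every other part; those parts then shrink to these
-- neighbourhoods, which have exactly the size that the induction hypothesis asks for with the same
-- `t`.
embedOrLowPair : ∀ k e (h : Fin k → Fin k → Bool) (G : Graph (Fin n)) (W : Subset n) t → 1 ≤ t →
  (B : Fin k → Subset n) → (∀ i → B i ⊆ W) → (∀ i → embedConst e k * t ≤ ∣ B i ∣) →
  (∀ i j → i ≢ j → B i # B j) →
  (∃[ f ] (∀ i → f i ∈ B i) × Embeds G h f) ⊎ (∃[ τ ] LowPair (colour G τ) W e t (embedConst e k * t))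
embedOrLowPair zero e h G W t 1≤t B B⊆W big disj = inj₁ ((λ ()) , (λ ()) , λ ())
embedOrLowPair {n} (suc k) e h G W t 1≤t B B⊆W big disj =
  search (Fin.any? λ v → (v ∈? B zero) ×-dec Fin.all? (λ j → s ≤? rich v j))
  where
  s : ℕ
  s = embedConst e k * t

  1≤s : 1 ≤ s
  1≤s = *-mono-≤ (1≤embedConst e k) 1≤t

  T≡ : embedConst e (suc k) * t ≡ s + e * s + k * (e * s)
  T≡ = lemma e k (embedConst e k) t
    where
    lemma : ∀ e k c t → (1 + e + k * e) * c * t ≡ c * t + e * (c * t) + k * (e * (c * t))
    lemma = solve-∀

  s≤T : s ≤ embedConst e (suc k) * t
  s≤T = subst (s ≤_) (sym T≡) (≤-trans (m≤m+n s (e * s)) (m≤m+n _ _))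

  rich : Fin n → Fin k → ℕ
  rich v j = deg (colour G (h zero (suc j))) v (B (suc j))

  Good : Fin n → Set
  Good v = v ∈ B zero × (∀ j → s ≤ rich v j)

  extend : ∀ {v} → v ∈ B zero → (N : Fin k → Subset n) →
    (∀ j {x} → x ∈ N j → Adj (colour G (h zero (suc j))) v x × x ∈ B (suc j)) →
    (∃[ f ] (∀ i → f i ∈ N i) × Embeds G (λ i j → h (suc i) (suc j)) f) →
    ∃[ f ] (∀ i → f i ∈ B i) × Embeds G h f
  extend {v} v∈B N N-spec (f , f∈N , f-emb) = f′ , f′∈B , f′-emb
    where
    f′ : Fin (suc k) → Fin n
    f′ zero    = v
    f′ (suc i) = f i
    f′∈B : ∀ i → f′ i ∈ B i
    f′∈B zero    = v∈B
    f′∈B (suc i) = proj₂ (N-spec i (f∈N i))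
    f′-emb : Embeds G h f′
    f′-emb zero    (suc j) _         = proj₁ (N-spec j (f∈N j))
    f′-emb (suc i) (suc j) (s≤s i<j) = f-emb i j i<j

  search : Dec (∃ Good) → _
  search (yes (v , v∈B , richv)) =
    [ inj₁ ∘ extend v∈B N N-spec , (λ (τ , P) → inj₂ (τ , LowPair-weaken s≤T P)) ]′
      (embedOrLowPair k e (λ i j → h (suc i) (suc j)) G W t 1≤t N
        (λ j → B⊆W (suc j) ∘ N⊆B j) richv
        (λ i j i≢j x∈Ni x∈Nj → disj (suc i) (suc j) (i≢j ∘ Fin.suc-injective) (N⊆B i x∈Ni) (N⊆B j x∈Nj)))
    where
    N : Fin k → Subset n
    N j = nbrs (colour G (h zero (suc j))) v ∩ B (suc j)
    N-spec : ∀ j {x} → x ∈ N j → Adj (colour G (h zero (suc j))) v x × x ∈ B (suc j)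
    N-spec j x∈ with x∈p∩q⁻ (nbrs (colour G (h zero (suc j))) v) (B (suc j)) x∈
    ... | x∈nbrs , x∈B = ∈-filter⁻ (Graph.adj? (colour G (h zero (suc j))) v) x∈nbrs , x∈B
    N⊆B : ∀ j → N j ⊆ B (suc j)
    N⊆B j = proj₂ ∘ N-spec j
  -- Now each vertex of `B zero` has fewer than `s` neighbours of the right colour in some other
  -- part. More than `e * s` of them share the same part `j`, and together with `B (suc j)` they
  -- form the low pair.
  search (no none) with pigeonhole k P (B zero) (e * s) enough cover
    where
    P : Fin k → Subset n
    P j = filter (λ v → rich v j <? s)
    cover : ∀ {v} → v ∈ B zero → ∃[ j ] v ∈ P j
    cover {v} v∈B with Fin.¬∀⟶∃¬ k _ (λ j → s ≤? rich v j) (λ all → none (v , v∈B , all))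
    ... | j , poor = j , ∈-filter⁺ (λ v → rich v j <? s) (≰⇒> poor)
    enough : k * (e * s) < ∣ B zero ∣
    enough = <-≤-trans
      (m<n+m (k * (e * s)) (≤-trans 1≤s (m≤m+n s (e * s))))
      (subst (_≤ ∣ B zero ∣) T≡ (big zero))
  ... | j , many = inj₂ (h zero (suc j) , record
    { s = s
    ; t≤s = m≤n⇒m≤o*n (embedConst e k) {{>-nonZero (1≤embedConst e k)}} ≤-refl
    ; s≤T = s≤T
    ; A = B zero ∩ filter (λ v → rich v j <? s) ; B = B (suc j)
    ; A⊆W = B⊆W zero ∘ p∩q⊆p _ _ ; B⊆W = B⊆W (suc j)
    ; A#B = λ x∈ → disj zero (suc j) (λ ()) (p∩q⊆p _ _ x∈)
    ; ∣A∣≥ = <⇒≤ many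
    ; ∣B∣≥ = ≤-trans (subst (e * s ≤_) (sym T≡) (≤-trans (m≤n+m (e * s) s) (m≤m+n _ _))) (big (suc j))
    ; low = λ x∈ → <⇒≤ (∈-filter⁻ (λ v → rich v j <? s) (p∩q⊆q (B zero) _ x∈))
    })

BiPair : Graph (Fin n) → Subset n → (e t T : ℕ) → Set
BiPair G W e t T = Σ (LowPair G W e t T) λ P → let open LowPair P in
  ∀ {b} → b ∈ B → deg G b A ≤ s

-- At most half of the vertices of B exceed twice the average degree into A.
symmetrise : {G : Graph (Fin n)} {W : Subset n} {e t T : ℕ} → 1 ≤ t →
  LowPair G W (4 * e) t T → BiPair G W e t (2 * T)
symmetrise {G = G} {W} {e} {t} {T} 1≤t P
  -- Both sides are cut to exactly `4 * e * s` vertices: double counting needs an upper bound on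
  -- `A`, and half of `B` is then `e * (2 * s)`.
  with trim (LowPair.A P) _ (LowPair.∣A∣≥ P) | trim (LowPair.B P) _ (LowPair.∣B∣≥ P)
... | A , A⊆ , ∣A∣≡ | B , B⊆ , ∣B∣≡ = record
    { s = 2 * s
    ; t≤s = ≤-trans t≤s (m≤m+n s _)
    ; s≤T = *-monoʳ-≤ 2 s≤T
    ; A = A ; B = B ∩ light
    ; A⊆W = A⊆W ∘ A⊆ ; B⊆W = B⊆W ∘ B⊆ ∘ p∩q⊆p B light
    ; A#B = λ x∈A x∈B → A#B (A⊆ x∈A) (B⊆ (p∩q⊆p B light x∈B))
    ; ∣A∣≥ = ≤-trans (m≤m+n _ _) (≤-reflexive (trans (double e s) (sym ∣A∣≡)))
    ; ∣B∣≥ = +-cancelʳ-≤ (e * (2 * s)) _ _ light-large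
    ; low = λ a∈A → ≤-trans (deg-mono G _ (B⊆ ∘ p∩q⊆p B light)) (≤-trans (low (A⊆ a∈A)) (m≤m+n s _))
    } , λ b∈ → ∈-filter⁻ (λ b → deg G b A ≤? 2 * s) (p∩q⊆q B light b∈)
  where
  open LowPair P hiding (A; B)
  open ≤-Reasoning
  light : Subset _
  light = filter (λ b → deg G b A ≤? 2 * s)
  double : ∀ e s → e * (2 * s) + e * (2 * s) ≡ 4 * e * s
  double = solve-∀
  instance
    2s≢0 : NonZero (2 * s)
    2s≢0 = >-nonZero (≤-trans 1≤t (≤-trans t≤s (m≤m+n s _)))
  heavy-small : ∣ B ─ light ∣ ≤ e * (2 * s)
  heavy-small = *-cancelʳ-≤ _ _ (2 * s) (begin
    ∣ B ─ light ∣ * (2 * s)  ≤⟨ doubleCount G A (B ─ light) (2 * s) s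
                                 (λ a∈A → ≤-trans (deg-mono G _ (B⊆ ∘ p─q⊆p B light)) (low (A⊆ a∈A)))
                                 (λ {y} y∈ → <⇒≤ (≰⇒> λ y-light →
                                   x∈p─q⇒x∉q B light y∈ (∈-filter⁺ (λ b → deg G b A ≤? 2 * s) y-light))) ⟩
    ∣ A ∣ * s                ≡⟨ cong (_* s) ∣A∣≡ ⟩
    4 * e * s * s            ≡⟨ regroup e s ⟩
    e * (2 * s) * (2 * s)    ∎)
    where
    regroup : ∀ e s → 4 * e * s * s ≡ e * (2 * s) * (2 * s)
    regroup = solve-∀
  light-large : e * (2 * s) + e * (2 * s) ≤ ∣ B ∩ light ∣ + e * (2 * s)
  light-large = begin
    e * (2 * s) + e * (2 * s)         ≡⟨ double e s ⟩
    4 * e * s                         ≡⟨ ∣B∣≡ ⟨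
    ∣ B ∣                             ≡⟨ ∣p∣≡∣p∩q∣+∣p─q∣ B light ⟩
    ∣ B ∩ light ∣ + ∣ B ─ light ∣     ≤⟨ +-monoʳ-≤ _ heavy-small ⟩
    ∣ B ∩ light ∣ + e * (2 * s)       ∎

-- The summand `k` provides the `k` disjoint parts, and the summand 2 covers the doubling of the
-- scale bound in `symmetrise`, which also explains the density parameter `4 * e`.
pairConst : ℕ → ℕ → ℕ
pairConst e k = (2 + k) * embedConst (4 * e) k

pairConst-split : ∀ k c t → 2 * (c * t) + k * (c * t) ≡ (2 + k) * c * t
pairConst-split = solve-∀

embedOrBiPair : ∀ k e (h : Fin k → Fin k → Bool) (G : Graph (Fin n)) (W : Subset n) t → 1 ≤ t →
  pairConst e k * t ≤ ∣ W ∣ →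
  (∃[ f ] Embeds G h f) ⊎ (∃[ τ ] BiPair (colour G τ) W e t (pairConst e k * t))
embedOrBiPair k e h G W t 1≤t large with disjointParts k (c * t) W parts
  where
  c : ℕ
  c = embedConst (4 * e) k
  parts : k * (c * t) ≤ ∣ W ∣
  parts = ≤-trans (≤-trans (m≤n+m _ (2 * (c * t))) (≤-reflexive (pairConst-split k c t))) large
... | B , B⊆W , big , disj with embedOrLowPair k (4 * e) h G W t 1≤t B B⊆W big disj
...   | inj₁ (f , _ , emb) = inj₁ (f , emb)
...   | inj₂ (τ , P) with symmetrise 1≤t P
...     | P′ , low′ = inj₂ (τ , LowPair-weaken bound P′ , low′)
  where
  bound : 2 * (embedConst (4 * e) k * t) ≤ pairConst e k * t
  bound = ≤-trans (m≤m+n _ (k * (embedConst (4 * e) k * t))) (≤-reflexive (pairConst-split k (embedConst (4 * e) k) t))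

-- Read as the union of r sets of size e * s with pairwise degrees at most s.
record SparseSet (G : Graph (Fin n)) (W : Subset n) (r e t T : ℕ) : Set where
  field
    s    : ℕ
    t≤s  : t ≤ s
    s≤T  : s ≤ T
    Q    : Subset n
    Q⊆W  : Q ⊆ W
    ∣Q∣≡ : ∣ Q ∣ ≡ r * (e * s)
    low  : ∀ {v} → v ∈ Q → deg G v Q ≤ (e + r) * s

SparseSet-empty : (G : Graph (Fin n)) (W : Subset n) (e t : ℕ) → SparseSet G W 0 e t (1 * t)
SparseSet-empty {n} G W e t = record
  { s = t ; t≤s = ≤-refl ; s≤T = ≤-reflexive (sym (*-identityˡ t)) ; Q = ⊥ ; Q⊆W = ⊥⊆
  ; ∣Q∣≡ = ∣⊥∣≡0 n ; low = λ v∈⊥ → ⊥-elim (∉⊥ v∈⊥) }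

SparseSet-weaken : {G : Graph (Fin n)} {W W′ : Subset n} {r e t t′ T T′ : ℕ} →
  W ⊆ W′ → t′ ≤ t → T ≤ T′ → SparseSet G W r e t T → SparseSet G W′ r e t′ T′
SparseSet-weaken W⊆W′ t′≤t T≤T′ S = record
  { SparseSet S
  ; t≤s = ≤-trans t′≤t (SparseSet.t≤s S)
  ; s≤T = ≤-trans (SparseSet.s≤T S) T≤T′
  ; Q⊆W = W⊆W′ ∘ SparseSet.Q⊆W S }

-- The inner set has the outer degree bound as the lower limit of its scale, so the outer pair adds
-- at most `S.s` to any degree. A vertex of the new part `A₀` may see all of `A₀`, at most `e * S.s`
-- vertices, and few of `S.Q`; a vertex of `S.Q` gains few neighbours in `A₀` because the pair is
-- low from both sides.
SparseSet-extend : {G : Graph (Fin n)} {W : Subset n} {E r e t T T′ : ℕ} (P : BiPair G W E t T) →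
  (S : SparseSet G (LowPair.B (proj₁ P)) r e (LowPair.s (proj₁ P)) T′) →
  e * SparseSet.s S ≤ ∣ LowPair.A (proj₁ P) ∣ →
  SparseSet G W (suc r) e t T′
SparseSet-extend {G = G} {r = r} {e} (P , P-low′) S room with trim (LowPair.A P) _ room
... | A₀ , A₀⊆A , ∣A₀∣≡ = record
    { s = S.s ; t≤s = ≤-trans P.t≤s S.t≤s ; s≤T = S.s≤T ; Q = A₀ ∪ S.Q
    ; Q⊆W = [ P.A⊆W ∘ A₀⊆A , P.B⊆W ∘ S.Q⊆W ]′ ∘ x∈p∪q⁻ A₀ S.Q
    ; ∣Q∣≡ = trans (∣p∪q∣≡∣p∣+∣q∣ A₀ S.Q λ x∈A₀ x∈Q → P.A#B (A₀⊆A x∈A₀) (S.Q⊆W x∈Q))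
                   (cong₂ _+_ ∣A₀∣≡ S.∣Q∣≡)
    ; low = λ {v} v∈ → ≤-trans (deg-∪ G v A₀ S.Q) (bound (x∈p∪q⁻ A₀ S.Q v∈)) }
  where
  module P = LowPair P
  module S = SparseSet S
  open ≤-Reasoning
  bound : ∀ {v} → v ∈ A₀ ⊎ v ∈ S.Q → deg G v A₀ + deg G v S.Q ≤ (e + suc r) * S.s
  bound {v} (inj₁ v∈A₀) = begin
    deg G v A₀ + deg G v S.Q   ≤⟨ +-mono-≤ (∣p∩q∣≤∣q∣ (nbrs G v) A₀) (deg-mono G v S.Q⊆W) ⟩
    ∣ A₀ ∣ + deg G v P.B       ≤⟨ +-mono-≤ (≤-reflexive ∣A₀∣≡) (≤-trans (P.low (A₀⊆A v∈A₀)) S.t≤s) ⟩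
    e * S.s + S.s              ≤⟨ m≤m+n _ (r * S.s) ⟩
    e * S.s + S.s + r * S.s    ≡⟨ regroup e r S.s ⟩
    (e + suc r) * S.s          ∎
    where
    regroup : ∀ e r s → e * s + s + r * s ≡ (e + suc r) * s
    regroup = solve-∀
  bound {v} (inj₂ v∈Q) = begin
    deg G v A₀ + deg G v S.Q   ≤⟨ +-mono-≤ (deg-mono G v A₀⊆A) (S.low v∈Q) ⟩
    deg G v P.A + (e + r) * S.s ≤⟨ +-monoˡ-≤ _ (≤-trans (P-low′ (S.Q⊆W v∈Q)) S.t≤s) ⟩
    S.s + (e + r) * S.s        ≡⟨ regroup e r S.s ⟩
    (e + suc r) * S.s          ∎
    where
    regroup : ∀ e r s → s + (e + r) * s ≡ (e + suc r) * s
    regroup = solve-∀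

-- Rödl's theorem, with degrees instead of densities.
embedOrSparseSet : ∀ k e p q → ∃[ D ] 1 ≤ D ×
  (∀ {n} (h : Fin k → Fin k → Bool) (G : Graph (Fin n)) (W : Subset n) t → 1 ≤ t → D * t ≤ ∣ W ∣ →
    (∃[ f ] Embeds G h f) ⊎
    SparseSet G W p e t (D * t) ⊎ SparseSet (complement G) W q e t (D * t))
embedOrSparseSet k e zero q = 1 , ≤-refl , λ h G W t _ _ → inj₂ (inj₁ (SparseSet-empty G W e t))
embedOrSparseSet k e (suc p) zero = 1 , ≤-refl , λ h G W t _ _ → inj₂ (inj₂ (SparseSet-empty _ W e t))
embedOrSparseSet k e (suc p) (suc q)
  with embedOrSparseSet k e p (suc q) | embedOrSparseSet k e (suc p) q
... | D₁ , 1≤D₁ , find₁ | D₂ , 1≤D₂ , find₂ = D , 1≤D , find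
  where
  -- The recursive calls run inside `B` of a pair, with the `s` of that pair as lower scale. The
  -- factor `C` in `E` makes `B` large enough for either call, and the factor `suc e` leaves room in
  -- `A` for `e` times the returned scale, which is at most `C * s`. In `D` the scale losses of the
  -- pair and of the call are multiplied.
  C E D : ℕ
  C = D₁ + D₂
  E = C * suc e
  D = C * pairConst E k

  1≤pairConst : 1 ≤ pairConst E k
  1≤pairConst = ≤-trans (1≤embedConst (4 * E) k) (m≤m+n _ _)

  1≤C : 1 ≤ C
  1≤C = ≤-trans 1≤D₁ (m≤m+n D₁ D₂)

  1≤D : 1 ≤ D
  1≤D = *-mono-≤ 1≤C 1≤pairConst

  pairConst≤D : ∀ t → pairConst E k * t ≤ D * t
  pairConst≤D t = *-monoˡ-≤ t (m≤n⇒m≤o*n C {{>-nonZero 1≤C}} ≤-refl)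

  scale : ∀ {D′} s t → D′ ≤ C → s ≤ pairConst E k * t → D′ * s ≤ D * t
  scale s t D′≤C s≤ = ≤-trans (*-mono-≤ D′≤C s≤) (≤-reflexive (sym (*-assoc C _ t)))

  inB : ∀ {D′} s → D′ ≤ C → D′ * s ≤ E * s
  inB s D′≤C = *-monoˡ-≤ s (≤-trans D′≤C (m≤m*n C (suc e)))

  inA : ∀ {D′ s s′} → D′ ≤ C → s′ ≤ D′ * s → e * s′ ≤ E * s
  inA {D′} {s} {s′} D′≤C s′≤ = begin
    e * s′         ≤⟨ *-mono-≤ (n≤1+n e) (≤-trans s′≤ (*-monoˡ-≤ s D′≤C)) ⟩
    suc e * (C * s) ≡⟨ regroup e C s ⟩
    E * s          ∎
    where
    open ≤-Reasoning
    regroup : ∀ e C s → suc e * (C * s) ≡ C * suc e * s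
    regroup = solve-∀

  find : ∀ {n} (h : Fin k → Fin k → Bool) (G : Graph (Fin n)) (W : Subset n) t → 1 ≤ t → D * t ≤ ∣ W ∣ →
    (∃[ f ] Embeds G h f) ⊎
    SparseSet G W (suc p) e t (D * t) ⊎ SparseSet (complement G) W (suc q) e t (D * t)
  find h G W t 1≤t large with embedOrBiPair k E h G W t 1≤t (≤-trans (pairConst≤D t) large)
  ... | inj₁ emb = inj₁ emb
  -- A pair sparse in `G` pays for one of the `suc p` parts: a sparse set of `G` found inside `B` is
  -- extended by a part of `A`, while a sparse set of the complement already has all `suc q` parts.
  ... | inj₂ (true , P , low′)
      with find₁ h G (LowPair.B P) (LowPair.s P) (≤-trans 1≤t (LowPair.t≤s P))
                 (≤-trans (inB _ (m≤m+n D₁ D₂)) (LowPair.∣B∣≥ P))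
  ...   | inj₁ emb      = inj₁ emb
  ...   | inj₂ (inj₁ S) = inj₂ (inj₁ (SparseSet-weaken id ≤-refl (scale _ t (m≤m+n D₁ D₂) (LowPair.s≤T P))
            (SparseSet-extend (P , low′) S
              (≤-trans (inA (m≤m+n D₁ D₂) (SparseSet.s≤T S)) (LowPair.∣A∣≥ P)))))
  ...   | inj₂ (inj₂ S) = inj₂ (inj₂ (SparseSet-weaken (LowPair.B⊆W P) (LowPair.t≤s P)
            (scale _ t (m≤m+n D₁ D₂) (LowPair.s≤T P)) S))
  find h G W t 1≤t large | inj₂ (false , P , low′)
      with find₂ h G (LowPair.B P) (LowPair.s P) (≤-trans 1≤t (LowPair.t≤s P))
                 (≤-trans (inB _ (m≤n+m D₂ D₁)) (LowPair.∣B∣≥ P))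
  ...   | inj₁ emb      = inj₁ emb
  ...   | inj₂ (inj₂ S) = inj₂ (inj₂ (SparseSet-weaken id ≤-refl (scale _ t (m≤n+m D₂ D₁) (LowPair.s≤T P))
            (SparseSet-extend (P , low′) S
              (≤-trans (inA (m≤n+m D₂ D₁) (SparseSet.s≤T S)) (LowPair.∣A∣≥ P)))))
  ...   | inj₂ (inj₁ S) = inj₂ (inj₁ (SparseSet-weaken (LowPair.B⊆W P) (LowPair.t≤s P)
            (scale _ t (m≤n+m D₂ D₁) (LowPair.s≤T P)) S))

-- Induced paths in sparse graphs

record AntiPair (G : Graph (Fin n)) (U : Subset n) (t : ℕ) : Set where
  field
    X Y  : Subset n
    X⊆U  : X ⊆ U
    Y⊆U  : Y ⊆ U
    X#Y  : X # Y
    ∣X∣≥ : t ≤ ∣ X ∣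
    ∣Y∣≥ : t ≤ ∣ Y ∣
    anti : Anticomplete G X Y

AntiPair-widen : {G : Graph (Fin n)} {U W : Subset n} {t t′ : ℕ} → U ⊆ W → t′ ≤ t →
  AntiPair G U t → AntiPair G W t′
AntiPair-widen U⊆W t′≤t P = record
  { AntiPair P
  ; X⊆U  = U⊆W ∘ AntiPair.X⊆U P
  ; Y⊆U  = U⊆W ∘ AntiPair.Y⊆U P
  ; ∣X∣≥ = ≤-trans t′≤t (AntiPair.∣X∣≥ P)
  ; ∣Y∣≥ = ≤-trans t′≤t (AntiPair.∣Y∣≥ P) }

crossEdge? : (G : Graph (Fin n)) (X Y : Subset n) →
  Dec (∃[ x ] ∃[ y ] x ∈ X × y ∈ Y × Adj G x y)
crossEdge? G X Y = Fin.any? λ x → Fin.any? λ y → (x ∈? X) ×-dec (y ∈? Y) ×-dec Graph.adj? G x y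

anticomplete? : (G : Graph (Fin n)) (X Y : Subset n) → Dec (Anticomplete G X Y)
anticomplete? G X Y with crossEdge? G X Y
... | yes (x , y , x∈X , y∈Y , xy) = no λ anti → anti x∈X y∈Y xy
... | no none = yes λ x∈X y∈Y xy → none (_ , _ , x∈X , y∈Y , xy)

-- These are the unions of components of the graph induced on `U`.
Separated : Graph (Fin n) → Subset n → Subset n → Set
Separated G U P = P ⊆ U × Anticomplete G P (U ─ P)

Separated-trans : (G : Graph (Fin n)) (U C P : Subset n) →
  Separated G U C → Separated G C P → Separated G U P
Separated-trans G U C P (C⊆U , C-anti) (P⊆C , P-anti) = C⊆U ∘ P⊆C , anti
  where
  anti : Anticomplete G P (U ─ P)
  anti {y = y} x∈P y∈ with y ∈? C
  ... | yes y∈C = P-anti x∈P (x∈p∧x∉q⇒x∈p─q y∈C (x∈p─q⇒x∉q U P y∈))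
  ... | no  y∉C = C-anti (P⊆C x∈P) (x∈p∧x∉q⇒x∈p─q (p─q⊆p U P y∈) y∉C)

Separated-rest : (G : Graph (Fin n)) (C P : Subset n) → Separated G C P → Separated G C (C ─ P)
Separated-rest G C P (P⊆C , P-anti) = p─q⊆p C P , anti
  where
  anti : Anticomplete G (C ─ P) (C ─ (C ─ P))
  anti {y = y} x∈ y∈ xy with y ∈? P
  ... | yes y∈P = P-anti y∈P x∈ (Graph.adj-sym G xy)
  ... | no  y∉P = x∈p─q⇒x∉q C (C ─ P) y∈ (x∈p∧x∉q⇒x∈p─q (p─q⊆p C (C ─ P) y∈) y∉P)

separationPair : {G : Graph (Fin n)} {U P : Subset n} {t : ℕ} →
  Separated G U P → t ≤ ∣ P ∣ → t ≤ ∣ U ─ P ∣ → AntiPair G U t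
separationPair {U = U} {P} (P⊆U , anti) bigP bigRest = record
  { X = P ; Y = U ─ P ; X⊆U = P⊆U ; Y⊆U = p─q⊆p U P
  ; X#Y = λ x∈P x∈U─P → x∈p─q⇒x∉q U P x∈U─P x∈P
  ; ∣X∣≥ = bigP ; ∣Y∣≥ = bigRest ; anti = anti }

ProperSeparation : Graph (Fin n) → Subset n → Subset n → Set
ProperSeparation G U P = Separated G U P × Nonempty P × Nonempty (U ─ P)

-- Phrased through separations instead of walks: it is decidable by a search over subsets, and it is
-- used only to obtain an edge leaving a proper nonempty subset. The empty set counts as connected.
Connected : Graph (Fin n) → Subset n → Set
Connected G U = ∀ P → ¬ ProperSeparation G U P

properSeparation? : (G : Graph (Fin n)) (U : Subset n) → Dec (∃ (ProperSeparation G U))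
properSeparation? G U = anySubset? λ P →
  (P ⊆? U ×-dec anticomplete? G P (U ─ P)) ×-dec nonempty? P ×-dec nonempty? (U ─ P)

LargeComponent : Graph (Fin n) → Subset n → ℕ → Set
LargeComponent G U t = ∃[ C ] Connected G C × Separated G U C × ∣ U ─ C ∣ ≤ t

-- m bounds the number of times C can still be split.
shrinkToComponent : ∀ m (G : Graph (Fin n)) (U C : Subset n) t → 3 * t ≤ ∣ U ∣ → ∣ C ∣ < m →
  Separated G U C → ∣ U ─ C ∣ ≤ t → AntiPair G U t ⊎ LargeComponent G U t
shrinkToComponent (suc m) G U C t large (s≤s ∣C∣≤m) sepC rest with properSeparation? G C
... | no none = inj₂ (C , (λ P sep → none (P , sep)) , sepC , rest)
... | yes (P , sepP , (x , x∈P) , (y , y∈C─P))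
  -- If `P` or `C ─ P` misses at most `t` vertices of `U`, the search continues with it. Otherwise
  -- each misses more than `t`, so whichever has at least `t` vertices forms an anticomplete pair
  -- with its rest. If both had fewer, `U` would have fewer than `3 * t` vertices.
  with ∣ U ─ P ∣ ≤? t | ∣ U ─ (C ─ P) ∣ ≤? t | t ≤? ∣ P ∣ | t ≤? ∣ C ─ P ∣
... | yes restP | _ | _ | _ =
  shrinkToComponent m G U P t large (<-≤-trans (p⊂q⇒∣p∣<∣q∣ P⊂C) ∣C∣≤m)
    (Separated-trans G U C P sepC sepP) restP
  where
  P⊂C : P ⊂ C
  P⊂C = proj₁ sepP , y , p─q⊆p C P y∈C─P , x∈p─q⇒x∉q C P y∈C─P
... | no _ | yes restQ | _ | _ =
  shrinkToComponent m G U (C ─ P) t large (<-≤-trans (p⊂q⇒∣p∣<∣q∣ Q⊂C) ∣C∣≤m)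
    (Separated-trans G U C (C ─ P) sepC (Separated-rest G C P sepP)) restQ
  where
  Q⊂C : C ─ P ⊂ C
  Q⊂C = p─q⊆p C P , x , proj₁ sepP x∈P , λ x∈C─P → x∈p─q⇒x∉q C P x∈C─P x∈P
... | no ¬restP | no _ | yes bigP | _ = inj₁ (separationPair (Separated-trans G U C P sepC sepP) bigP (≰⇒≥ ¬restP))
... | no _ | no ¬restQ | no _ | yes bigQ =
  inj₁ (separationPair (Separated-trans G U C (C ─ P) sepC (Separated-rest G C P sepP)) bigQ (≰⇒≥ ¬restQ))
... | no _ | no _ | no ¬bigP | no ¬bigQ = ⊥-elim (<-irrefl refl (begin-strict
  3 * t                              ≤⟨ large ⟩
  ∣ U ∣                              ≤⟨ ∣p∣≤∣q∣+∣p─q∣ U C ⟩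
  ∣ C ∣ + ∣ U ─ C ∣                  ≤⟨ +-mono-≤ (∣p∣≤∣q∣+∣p─q∣ C P) rest ⟩
  ∣ P ∣ + ∣ C ─ P ∣ + t              <⟨ +-monoˡ-< t (+-mono-< (≰⇒> ¬bigP) (≰⇒> ¬bigQ)) ⟩
  t + t + t                          ≡⟨ triple t ⟩
  3 * t                              ∎))
  where
  open ≤-Reasoning
  triple : ∀ t → t + t + t ≡ 3 * t
  triple = solve-∀

largeComponent : (G : Graph (Fin n)) (U : Subset n) (t : ℕ) → 3 * t ≤ ∣ U ∣ →
  AntiPair G U t ⊎ LargeComponent G U t
largeComponent G U t large =
  shrinkToComponent (suc ∣ U ∣) G U U t large ≤-refl
    (id , λ _ y∈ → contradiction (p─q⊆p U U y∈) (x∈p─q⇒x∉q U U y∈))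
    (subst (_≤ t) (sym empty) z≤n)
  where
  empty : ∣ U ─ U ∣ ≡ 0
  empty with ∣ U ─ U ∣ in eq
  ... | zero = refl
  ... | suc _ with nonempty-of-pos (U ─ U) (subst (1 ≤_) (sym eq) (s≤s z≤n))
  ...   | x , x∈ = contradiction (p─q⊆p U U x∈) (x∈p─q⇒x∉q U U x∈)

closedNbrs : Graph (Fin n) → Fin n → Subset n
closedNbrs G v = nbrs G v ∪ ⁅ v ⁆

∈-closedNbrs⁻ : (G : Graph (Fin n)) (v : Fin n) {x : Fin n} → x ∈ closedNbrs G v → Adj G v x ⊎ x ≡ v
∈-closedNbrs⁻ G v x∈ with x∈p∪q⁻ (nbrs G v) ⁅ v ⁆ x∈
... | inj₁ x∈N = inj₁ (∈-filter⁻ (Graph.adj? G v) x∈N)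
... | inj₂ x∈v = inj₂ (x∈⁅y⁆⇒x≡y v x∈v)

Adj⇒∈-closedNbrs : (G : Graph (Fin n)) {v x : Fin n} → Adj G v x → x ∈ closedNbrs G v
Adj⇒∈-closedNbrs G {v} vx = x∈p∪q⁺ (inj₁ (∈-filter⁺ (Graph.adj? G v) vx))

self∈closedNbrs : (G : Graph (Fin n)) (v : Fin n) → v ∈ closedNbrs G v
self∈closedNbrs G v = x∈p∪q⁺ (inj₂ (x∈⁅x⁆ v))

-- If the path ends in `v`, the next vertex is `w` and all later ones come from `C`, which avoids
-- `v` and its neighbours. The vertex `c` shows that `w` is attached to `C`, so that the step can be
-- repeated. The last field bounds the cost of one step by `d + t`.
record PathStep (G : Graph (Fin n)) (U : Subset n) (v : Fin n) (d t : ℕ) : Set where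
  field
    w        : Fin n
    w∈U      : w ∈ U
    vw       : Adj G v w
    C        : Subset n
    C⊆       : C ⊆ U ─ closedNbrs G v
    conn     : Connected G C
    c        : Fin n
    c∈C      : c ∈ C
    wc       : Adj G w c
    ∣U∣≤     : ∣ U ∣ ≤ d + t + ∣ C ∣

-- C is a component of U minus the closed neighbourhood of v, so an edge leaving C inside the
-- connected set U can only end in a neighbour of v.
pathStep : (G : Graph (Fin n)) (U : Subset n) (v y : Fin n) (d t : ℕ) → 1 ≤ t → Connected G U →
  y ∈ U → y ∈ closedNbrs G v → ∣ U ∩ closedNbrs G v ∣ ≤ d → d + 3 * t ≤ ∣ U ∣ →
  AntiPair G U t ⊎ PathStep G U v d t
pathStep G U v y d t 1≤t connU y∈U y∈N few large
  with largeComponent G (U ─ closedNbrs G v) t enough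
  where
  open ≤-Reasoning
  enough : 3 * t ≤ ∣ U ─ closedNbrs G v ∣
  enough = +-cancelˡ-≤ d _ _ (begin
    d + 3 * t                                           ≤⟨ large ⟩
    ∣ U ∣                                               ≡⟨ ∣p∣≡∣p∩q∣+∣p─q∣ U (closedNbrs G v) ⟩
    ∣ U ∩ closedNbrs G v ∣ + ∣ U ─ closedNbrs G v ∣     ≤⟨ +-monoˡ-≤ _ few ⟩
    d + ∣ U ─ closedNbrs G v ∣                          ∎)
... | inj₁ pair = inj₁ (AntiPair-widen (p─q⊆p U _) ≤-refl pair)
... | inj₂ (C , connC , (C⊆ , C-anti) , rest) = findEdge (crossEdge? G C (U ─ C))
  where
  open ≤-Reasoning
  N : Subset _
  N = closedNbrs G v
  bound : ∣ U ∣ ≤ d + t + ∣ C ∣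
  bound = begin
    ∣ U ∣                               ≡⟨ ∣p∣≡∣p∩q∣+∣p─q∣ U N ⟩
    ∣ U ∩ N ∣ + ∣ U ─ N ∣               ≤⟨ +-mono-≤ few (∣p∣≤∣q∣+∣p─q∣ (U ─ N) C) ⟩
    d + (∣ C ∣ + ∣ (U ─ N) ─ C ∣)       ≤⟨ +-monoʳ-≤ d (+-monoʳ-≤ ∣ C ∣ rest) ⟩
    d + (∣ C ∣ + t)                     ≡⟨ regroup d ∣ C ∣ t ⟩
    d + t + ∣ C ∣                       ∎
    where
    regroup : ∀ d c t → d + (c + t) ≡ d + t + c
    regroup = solve-∀
  C-nonempty : Nonempty C
  C-nonempty = nonempty-of-pos C (≤-trans 1≤t (+-cancelˡ-≤ (d + t) _ _ (begin
    d + t + t        ≤⟨ m≤m+n _ t ⟩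
    d + t + t + t    ≡⟨ regroup d t ⟩
    d + 3 * t        ≤⟨ large ⟩
    ∣ U ∣            ≤⟨ bound ⟩
    d + t + ∣ C ∣    ∎)))
    where
    regroup : ∀ d t → d + t + t + t ≡ d + 3 * t
    regroup = solve-∀
  findEdge : Dec (∃[ c ] ∃[ w ] c ∈ C × w ∈ U ─ C × Adj G c w) → AntiPair G U t ⊎ PathStep G U v d t
  -- Without an edge leaving `C`, the set `C` would be a proper separation of `U`: it is nonempty,
  -- and `y` lies outside it because `C` avoids the closed neighbourhood of `v`.
  findEdge (no none) = ⊥-elim (connU C
    ( (p─q⊆p U N ∘ C⊆ , λ c∈C w∈ cw → none (_ , _ , c∈C , w∈ , cw))
    , C-nonempty
    , y , x∈p∧x∉q⇒x∈p─q y∈U (λ y∈C → x∈p─q⇒x∉q U N (C⊆ y∈C) y∈N)))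
  findEdge (yes (c , w , c∈C , w∈ , cw)) = inj₂ record
    { w = w ; w∈U = w∈U ; vw = vw ; C = C ; C⊆ = C⊆ ; conn = connC
    ; c = c ; c∈C = c∈C ; wc = Graph.adj-sym G cw ; ∣U∣≤ = bound }
    where
    w∈U : w ∈ U
    w∈U = p─q⊆p U C w∈
    vw : Adj G v w
    vw with w ∈? N
    ... | no w∉N = contradiction cw
            (C-anti c∈C (x∈p∧x∉q⇒x∈p─q (x∈p∧x∉q⇒x∈p─q w∈U w∉N) (x∈p─q⇒x∉q U C w∈)))
    ... | yes w∈N with ∈-closedNbrs⁻ G v w∈N
    ...   | inj₁ vw   = vw
    -- If `w` were `v`, its neighbour `c` would lie in the closed neighbourhood that `C` avoids.
    ...   | inj₂ refl = contradiction (Adj⇒∈-closedNbrs G (Graph.adj-sym G cw)) (x∈p─q⇒x∉q U N (C⊆ c∈C))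

edgeColour : ∀ {k} → Graph (Fin k) → Fin k → Fin k → Bool
edgeColour H i j = does (Graph.adj? H i j)

-- Here `v` is the current end of the path and `U` the connected reservoir for the later vertices.
-- The vertex `y` witnesses that `v` lies in `U` or has a neighbour there: the first alternative
-- occurs at the start, the second afterwards. Each of the `m` steps costs at most `d + t` vertices,
-- and `3 * t` are kept for finding a large component.
growPath : ∀ m (G : Graph (Fin n)) (Q : Subset n) (d t : ℕ) → 1 ≤ t →
  (∀ {v} → v ∈ Q → ∣ Q ∩ closedNbrs G v ∣ ≤ d) →
  (U : Subset n) → U ⊆ Q → Connected G U → (v y : Fin n) → v ∈ Q → y ∈ U → y ∈ closedNbrs G v →
  m * (d + t) + 3 * t ≤ ∣ U ∣ →
  AntiPair G Q t ⊎
  Σ (Fin (suc m) → Fin n) λ f →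
    f zero ≡ v × (∀ i → f (suc i) ∈ U) × Embeds G (edgeColour (path (suc m))) f
growPath zero G Q d t 1≤t low U U⊆Q connU v y v∈Q y∈U y∈N large =
  inj₂ ((λ _ → v) , refl , (λ ()) , λ { zero zero () })
growPath {n} (suc m) G Q d t 1≤t low U U⊆Q connU v y v∈Q y∈U y∈N large
  with pathStep G U v y d t 1≤t connU y∈U y∈N few enough
  where
  few : ∣ U ∩ closedNbrs G v ∣ ≤ d
  few = ≤-trans (p⊆q⇒∣p∣≤∣q∣ λ x∈ → x∈p∩q⁺ (U⊆Q (p∩q⊆p U _ x∈) , p∩q⊆q U _ x∈)) (low v∈Q)
  enough : d + 3 * t ≤ ∣ U ∣
  enough = ≤-trans (+-monoˡ-≤ (3 * t) (≤-trans (m≤m+n d t) (m≤m+n (d + t) (m * (d + t))))) large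
... | inj₁ pair = inj₁ (AntiPair-widen U⊆Q ≤-refl pair)
... | inj₂ step
  with growPath m G Q d t 1≤t low C (U⊆Q ∘ p─q⊆p U _ ∘ C⊆) conn w c (U⊆Q w∈U) c∈C
         (Adj⇒∈-closedNbrs G wc) enough
  where
  open PathStep step
  open ≤-Reasoning
  enough : m * (d + t) + 3 * t ≤ ∣ C ∣
  enough = +-cancelˡ-≤ (d + t) _ _ (begin
    d + t + (m * (d + t) + 3 * t)   ≡⟨ +-assoc (d + t) _ _ ⟨
    d + t + m * (d + t) + 3 * t     ≤⟨ large ⟩
    ∣ U ∣                           ≤⟨ ∣U∣≤ ⟩
    d + t + ∣ C ∣                   ∎)
... | inj₁ pair = inj₁ pair
... | inj₂ (g , g0≡w , g∈C , g-emb) = inj₂ (f , refl , f∈U , f-emb)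
  where
  open PathStep step
  f : Fin (suc (suc m)) → Fin n
  f zero    = v
  f (suc i) = g i
  f∈U : ∀ i → f (suc i) ∈ U
  f∈U zero    = subst (_∈ U) (sym g0≡w) w∈U
  f∈U (suc i) = p─q⊆p U _ (C⊆ (g∈C i))
  f-emb : Embeds G (edgeColour (path (suc (suc m)))) f
  f-emb zero    (suc zero)    _         = subst (Adj G v) (sym g0≡w) vw
  -- From the third vertex on, the path lies in `C`, hence outside the closed neighbourhood of `v`;
  -- this gives both distinctness and nonadjacency.
  f-emb zero    (suc (suc j)) _         =
    (λ eq → g∉N (subst (_∈ closedNbrs G v) eq (self∈closedNbrs G v))) , g∉N ∘ Adj⇒∈-closedNbrs G
    where
    g∉N : g (suc j) ∉ closedNbrs G v
    g∉N = x∈p─q⇒x∉q U _ (C⊆ (g∈C j))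
  f-emb (suc i) (suc j)       (s≤s i<j) = g-emb i j i<j

-- The fourth `t` pays for the initial passage from `Q` to a connected subset, any vertex of which
-- can start the path.
pathOrAntiPair : ∀ m (G : Graph (Fin n)) (Q : Subset n) (d t : ℕ) → 1 ≤ t →
  (∀ {v} → v ∈ Q → ∣ Q ∩ closedNbrs G v ∣ ≤ d) → m * (d + t) + 4 * t ≤ ∣ Q ∣ →
  AntiPair G Q t ⊎ ∃ (Embeds G (edgeColour (path (suc m))))
pathOrAntiPair m G Q d t 1≤t low large
  with largeComponent G Q t (≤-trans (*-monoˡ-≤ t (n≤1+n 3)) (≤-trans (m≤n+m _ (m * (d + t))) large))
... | inj₁ pair = inj₁ pair
... | inj₂ (C , conn , (C⊆Q , _) , rest) = fromVertex (nonempty-of-pos C (≤-trans 1≤t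
    (≤-trans (≤-trans (m≤m+n t _) (m≤n+m (3 * t) (m * (d + t)))) enough)))
  where
  open ≤-Reasoning
  enough : m * (d + t) + 3 * t ≤ ∣ C ∣
  enough = +-cancelʳ-≤ t _ _ (begin
    m * (d + t) + 3 * t + t    ≡⟨ regroup (m * (d + t)) t ⟩
    m * (d + t) + 4 * t        ≤⟨ large ⟩
    ∣ Q ∣                      ≤⟨ ∣p∣≤∣q∣+∣p─q∣ Q C ⟩
    ∣ C ∣ + ∣ Q ─ C ∣          ≤⟨ +-monoʳ-≤ ∣ C ∣ rest ⟩
    ∣ C ∣ + t                  ∎)
    where
    regroup : ∀ a t → a + 3 * t + t ≡ a + 4 * t
    regroup = solve-∀
  fromVertex : Nonempty C → AntiPair G Q t ⊎ ∃ (Embeds G (edgeColour (path (suc m))))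
  fromVertex (v , v∈C) with growPath m G Q d t 1≤t low C C⊆Q conn v v (C⊆Q v∈C) v∈C (self∈closedNbrs G v) enough
  ... | inj₁ pair              = inj₁ pair
  ... | inj₂ (f , _ , _ , emb) = inj₂ (f , emb)

-- From embeddings to induced subgraphs

module _ {n k} (G : Graph (Fin n)) (H : Graph (Fin k)) {f : Fin k → Fin n}
         (emb : Embeds G (edgeColour H) f) where

  private
    module G = Graph G
    module H = Graph H

    adj-< : ∀ i j → i Fin.< j → (Adj G (f i) (f j) → Adj H i j) × (Adj H i j → Adj G (f i) (f j))
    adj-< i j i<j with H.adj? i j | emb i j i<j
    ... | yes ij | fij       = (λ _ → ij) , (λ _ → fij)
    ... | no ¬ij | _ , ¬fij  = (λ fij → contradiction fij ¬fij) , (λ ij → contradiction ij ¬ij)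

    adj : ∀ i j → (Adj G (f i) (f j) → Adj H i j) × (Adj H i j → Adj G (f i) (f j))
    adj i j with Fin.<-cmp i j
    ... | tri< i<j _ _  = adj-< i j i<j
    ... | tri> _ _ j<i  = H.adj-sym ∘ proj₁ (adj-< j i j<i) ∘ G.adj-sym ,
                          G.adj-sym ∘ proj₂ (adj-< j i j<i) ∘ H.adj-sym
    ... | tri≈ _ refl _ = (λ ii → ⊥-elim (G.adj-irrefl refl ii)) , (λ ii → ⊥-elim (H.adj-irrefl refl ii))

    distinct : ∀ i j → i Fin.< j → f i ≢ f j
    distinct i j i<j eq = Graph.adj-irrefl (colour G (edgeColour H i j)) eq (emb i j i<j)

    injective : ∀ i j → f i ≡ f j → i ≡ j
    injective i j eq with Fin.<-cmp i j
    ... | tri< i<j _ _ = contradiction eq (distinct i j i<j)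
    ... | tri≈ _ i≡j _ = i≡j
    ... | tri> _ _ j<i = contradiction (sym eq) (distinct j i j<i)

    inImage? : (x : Fin n) → Dec (∃[ i ] f i ≡ x)
    inImage? x = Fin.any? λ i → f i Fin.≟ x

    preimage : (u : ∃ (_∈ filter inImage?)) → ∃[ i ] f i ≡ proj₁ u
    preimage (_ , x∈) = ∈-filter⁻ inImage? x∈

    ∈-≡ : {S : Subset n} {u v : ∃ (_∈ S)} → proj₁ u ≡ proj₁ v → u ≡ v
    ∈-≡ {u = _ , p} {_ , q} refl = cong (_ ,_) ([]=-irrelevant p q)

  -- The vertex set is the image of `f`, and the inverse map finds a preimage by search. The two
  -- maps are mutually inverse because `f` is injective and because membership proofs are unique, so
  -- that elements of the image are equal once their vertices are.
  Embeds⇒ContainsInduced : ContainsInduced G H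
  Embeds⇒ContainsInduced = filter inImage? ,
    mk↔ₛ′ (proj₁ ∘ preimage) (λ i → f i , ∈-filter⁺ inImage? (i , refl))
          (λ i → injective _ _ (proj₂ (preimage (f i , ∈-filter⁺ inImage? (i , refl)))))
          (λ u → ∈-≡ (proj₂ (preimage u))) ,
    λ u v → let i , fi≡u = preimage u
                j , fj≡v = preimage v
            in mk⇔ (proj₁ (adj i j) ∘ subst₂ (Adj G) (sym fi≡u) (sym fj≡v))
                   (subst₂ (Adj G) fi≡u fj≡v ∘ proj₂ (adj i j))

-- This turns a path found in the complement into an induced complement of a path in `G`. At a
-- nonedge of `H` the hypothesis is a doubly negated adjacency, which decidability resolves.
Embeds-complement : ∀ {k} (G : Graph (Fin n)) (H : Graph (Fin k)) {f : Fin k → Fin n} →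
  Embeds (complement G) (edgeColour H) f → Embeds G (edgeColour (complement H)) f
Embeds-complement G H {f} emb i j i<j with i Fin.≟ j | Graph.adj? H i j | emb i j i<j
... | yes i≡j | _     | _                = contradiction i<j (Fin.<-irrefl i≡j)
... | no _    | yes _ | fij              = fij
... | no _    | no _  | fi≢fj , ¬co      =
  decidable-stable (Graph.adj? G (f i) (f j)) λ ¬fij → ¬co (fi≢fj , ¬fij)

-- Linear pure pairs

∣U∩closedNbrs∣≤ : (G : Graph (Fin n)) (U : Subset n) (v : Fin n) →
  ∣ U ∩ closedNbrs G v ∣ ≤ deg G v U + 1
∣U∩closedNbrs∣≤ G U v = begin
  ∣ U ∩ closedNbrs G v ∣          ≤⟨ p⊆q⇒∣p∣≤∣q∣ sub ⟩
  ∣ (nbrs G v ∩ U) ∪ ⁅ v ⁆ ∣      ≤⟨ ∣p∪q∣≤∣p∣+∣q∣ (nbrs G v ∩ U) ⁅ v ⁆ ⟩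
  deg G v U + ∣ ⁅ v ⁆ ∣           ≡⟨ cong (_+_ (deg G v U)) (∣⁅x⁆∣≡1 v) ⟩
  deg G v U + 1                   ∎
  where
  open ≤-Reasoning
  sub : U ∩ closedNbrs G v ⊆ (nbrs G v ∩ U) ∪ ⁅ v ⁆
  sub x∈ with x∈p∩q⁻ U (closedNbrs G v) x∈
  ... | x∈U , x∈N with x∈p∪q⁻ (nbrs G v) ⁅ v ⁆ x∈N
  ...   | inj₁ x∈nbrs = x∈p∪q⁺ (inj₁ (x∈p∩q⁺ (x∈nbrs , x∈U)))
  ...   | inj₂ x∈v    = x∈p∪q⁺ (inj₂ x∈v)

-- Opaque, because embedOrSparseSet would otherwise unfold at the canonical form suc _ of 4 * suc m.
opaque
  parts : ℕ → ℕ
  parts m = 4 * suc m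

  parts≡ : ∀ m → parts m ≡ 4 * suc m
  parts≡ m = refl

-- With `r = parts m`, closed neighbourhoods within `Q` have at most `2 * r * s + s` vertices, so
-- one path step costs at most `3 * r * s`. The `m` steps and the reserve `4 * s` fit into
-- `4 * suc m * (r * s)`, which is the size `r * (r * s)` of `Q` by the choice of `r`.
SparseSet⇒pathOrAntiPair : ∀ m (G : Graph (Fin n)) (W : Subset n) {t T : ℕ} → 1 ≤ t →
  SparseSet G W (parts m) (parts m) t T →
  AntiPair G W t ⊎ ∃ (Embeds G (edgeColour (path (suc m))))
SparseSet⇒pathOrAntiPair m G W {t} 1≤t S
  with pathOrAntiPair m G Q ((r + r) * s + s) s 1≤s few large
  where
  open SparseSet S
  open ≤-Reasoning
  r : ℕ
  r = parts m
  1≤s : 1 ≤ s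
  1≤s = ≤-trans 1≤t t≤s
  few : ∀ {v} → v ∈ Q → ∣ Q ∩ closedNbrs G v ∣ ≤ (r + r) * s + s
  few {v} v∈Q = ≤-trans (∣U∩closedNbrs∣≤ G Q v) (+-mono-≤ (low v∈Q) 1≤s)
  large : m * ((r + r) * s + s + s) + 4 * s ≤ ∣ Q ∣
  large = begin
    m * ((r + r) * s + s + s) + 4 * s              ≡⟨ cong (λ x → m * x + 4 * s) (+-assoc ((r + r) * s) s s) ⟩
    m * ((r + r) * s + (s + s)) + 4 * s            ≤⟨ +-mono-≤ (*-mono-≤ (n≤1+n m) (+-monoʳ-≤ ((r + r) * s) 2s≤)) 4s≤ ⟩
    suc m * ((r + r) * s + r * s) + suc m * (r * s) ≡⟨ trans (regroup (suc m) r s) (cong (_* (r * s)) (sym (parts≡ m))) ⟩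
    r * (r * s)                                    ≡⟨ ∣Q∣≡ ⟨
    ∣ Q ∣                                          ∎
    where
    4≤r : 4 ≤ r
    4≤r = subst (4 ≤_) (sym (parts≡ m)) (*-monoʳ-≤ 4 (s≤s z≤n))
    2s≤ : s + s ≤ r * s
    2s≤ = ≤-trans (+-monoʳ-≤ s (m≤m+n s _)) (*-monoˡ-≤ s 4≤r)
    4s≤ : 4 * s ≤ suc m * (r * s)
    4s≤ = ≤-trans (*-monoˡ-≤ s 4≤r) (m≤m+n (r * s) _)
    regroup : ∀ q r s → q * ((r + r) * s + r * s) + q * (r * s) ≡ 4 * q * (r * s)
    regroup = solve-∀
... | inj₁ pair = inj₁ (AntiPair-widen (SparseSet.Q⊆W S) (SparseSet.t≤s S) pair)
... | inj₂ emb  = inj₂ emb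

record PurePair (G : Graph (Fin n)) (W : Subset n) (D : ℕ) : Set where
  field
    X Y  : Subset n
    X⊆W  : X ⊆ W
    Y⊆W  : Y ⊆ W
    X#Y  : X # Y
    ∣X∣≥ : ∣ W ∣ ≤ D * ∣ X ∣
    ∣Y∣≥ : ∣ W ∣ ≤ D * ∣ Y ∣
    pure : Complete G X Y ⊎ Anticomplete G X Y

AntiPair⇒PurePair : {G : Graph (Fin n)} {W : Subset n} {t D : ℕ} → ∣ W ∣ ≤ D * t →
  AntiPair G W t → PurePair G W D
AntiPair⇒PurePair {D = D} W≤ P = record
  { AntiPair P ; X⊆W = X⊆U ; Y⊆W = Y⊆U ; pure = inj₂ anti
  ; ∣X∣≥ = ≤-trans W≤ (*-monoʳ-≤ D ∣X∣≥) ; ∣Y∣≥ = ≤-trans W≤ (*-monoʳ-≤ D ∣Y∣≥) }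
  where open AntiPair P

-- Anticompleteness in the complement excludes only nonadjacent distinct pairs, so `X#Y` is used to
-- supply distinctness.
PurePair-complement : {G : Graph (Fin n)} {W : Subset n} {D : ℕ} →
  PurePair (complement G) W D → PurePair G W D
PurePair-complement {G = G} P = record { PurePair P ; pure = pure′ pure }
  where
  open PurePair P
  pure′ : Complete (complement G) X Y ⊎ Anticomplete (complement G) X Y → Complete G X Y ⊎ Anticomplete G X Y
  pure′ (inj₁ comp) = inj₂ λ x∈X y∈Y → proj₂ (comp x∈X y∈Y)
  pure′ (inj₂ anti) = inj₁ λ {x} {y} x∈X y∈Y → decidable-stable (Graph.adj? G x y) λ ¬xy →
    anti x∈X y∈Y ((λ { refl → X#Y x∈X y∈Y }) , ¬xy)

-- For sets too small for the sparse set argument, one vertex is already a fraction `1 / D` of `W`,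
-- and any two vertices form a pure pair.
twoVertexPair : (G : Graph (Fin n)) (W : Subset n) (D : ℕ) → 2 ≤ ∣ W ∣ → ∣ W ∣ ≤ D → PurePair G W D
twoVertexPair G W D 2≤W W≤D with nonempty-of-pos W (≤-trans (s≤s z≤n) 2≤W)
... | x , x∈W with nonempty-of-pos (W - x) (+-cancelˡ-≤ 1 _ _
                     (≤-trans 2≤W (subst (λ c → ∣ W ∣ ≤ c + ∣ W - x ∣) (∣⁅x⁆∣≡1 x) (∣p∣≤∣q∣+∣p─q∣ W ⁅ x ⁆))))
...   | y , y∈W-x = record
  { X = ⁅ x ⁆ ; Y = ⁅ y ⁆
  ; X⊆W = λ z∈ → subst (_∈ W) (sym (x∈⁅y⁆⇒x≡y x z∈)) x∈W
  ; Y⊆W = λ z∈ → subst (_∈ W) (sym (x∈⁅y⁆⇒x≡y y z∈)) (p─q⊆p W ⁅ x ⁆ y∈W-x)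
  ; X#Y = λ z∈x z∈y → x∈p─q⇒x∉q W ⁅ x ⁆ y∈W-x (subst (_∈ ⁅ x ⁆) (x∈⁅y⁆⇒x≡y y z∈y) z∈x)
  ; ∣X∣≥ = size x ; ∣Y∣≥ = size y ; pure = pure }
  where
  size : ∀ z → ∣ W ∣ ≤ D * ∣ ⁅ z ⁆ ∣
  size z = subst (∣ W ∣ ≤_) (sym (trans (cong (D *_) (∣⁅x⁆∣≡1 z)) (*-identityʳ D))) W≤D
  pure : Complete G ⁅ x ⁆ ⁅ y ⁆ ⊎ Anticomplete G ⁅ x ⁆ ⁅ y ⁆
  pure with Graph.adj? G x y
  ... | yes xy = inj₁ λ u∈ v∈ → subst₂ (Adj G) (sym (x∈⁅y⁆⇒x≡y x u∈)) (sym (x∈⁅y⁆⇒x≡y y v∈)) xy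
  ... | no ¬xy = inj₂ λ u∈ v∈ uv → ¬xy (subst₂ (Adj G) (x∈⁅y⁆⇒x≡y x u∈) (x∈⁅y⁆⇒x≡y y v∈) uv)

-- Stated for all vertex subsets of a fixed graph, so that it can be iterated.
StrongErdosHajnal : ℕ → ℕ → Set₁
StrongErdosHajnal k D = ∀ {n} (G : Graph (Fin n)) →
  ¬ ContainsInduced G (path k) → ¬ ContainsInduced G (complement (path k)) →
  ∀ W → 2 ≤ ∣ W ∣ → PurePair G W D

-- Rödl's theorem is applied at the scale `t = ∣ W ∣ / D`. Rounding down loses at most a factor 2
-- when `t` is positive, whence the constant `2 * D`. The form `2 + d` records that the constant is
-- at least 2, which the later iteration uses.
strongErdosHajnal : ∀ m → ∃[ d ] StrongErdosHajnal (suc m) (2 + d)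
strongErdosHajnal m with embedOrSparseSet (suc m) (parts m) (parts m) (parts m)
... | D@(suc d) , _ , find = d + (d + 0) , subst (StrongErdosHajnal (suc m)) (double d) pair
  where
  double : ∀ d → 2 * suc d ≡ 2 + (d + (d + 0))
  double = solve-∀
  pair : StrongErdosHajnal (suc m) (2 * D)
  pair G noPath noCopath W 2≤W with D ≤? ∣ W ∣
  ... | no small = twoVertexPair G W (2 * D) 2≤W (≤-trans (≰⇒≥ small) (m≤m+n D _))
  ... | yes large = fromFind (find (edgeColour (path (suc m))) G W t 1≤t
                       (≤-trans (≤-reflexive (*-comm D t)) (m/n*n≤m ∣ W ∣ D)))
    where
    open ≤-Reasoning
    t : ℕ
    t = ∣ W ∣ / D
    1≤t : 1 ≤ t
    1≤t = m≥n⇒m/n>0 large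
    W≤ : ∣ W ∣ ≤ 2 * D * t
    W≤ = begin
      ∣ W ∣                  ≡⟨ m≡m%n+[m/n]*n ∣ W ∣ D ⟩
      ∣ W ∣ % D + t * D      ≤⟨ +-monoˡ-≤ (t * D) (m%n≤n ∣ W ∣ D) ⟩
      D + t * D              ≤⟨ +-monoˡ-≤ (t * D) (m≤n*m D t {{>-nonZero 1≤t}}) ⟩
      t * D + t * D          ≡⟨ regroup t D ⟩
      2 * D * t              ∎
      where
      regroup : ∀ t D → t * D + t * D ≡ 2 * D * t
      regroup = solve-∀
    fromFind : (∃[ f ] Embeds G (edgeColour (path (suc m))) f) ⊎
      SparseSet G W (parts m) (parts m) t (D * t) ⊎ SparseSet (complement G) W (parts m) (parts m) t (D * t) →
      PurePair G W (2 * D)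
    fromFind (inj₁ (_ , emb)) = ⊥-elim (noPath (Embeds⇒ContainsInduced G (path (suc m)) emb))
    fromFind (inj₂ (inj₁ S)) with SparseSet⇒pathOrAntiPair m G W 1≤t S
    ... | inj₁ P         = AntiPair⇒PurePair W≤ P
    ... | inj₂ (_ , emb) = ⊥-elim (noPath (Embeds⇒ContainsInduced G (path (suc m)) emb))
    fromFind (inj₂ (inj₂ S)) with SparseSet⇒pathOrAntiPair m (complement G) W 1≤t S
    ... | inj₁ P         = PurePair-complement (AntiPair⇒PurePair W≤ P)
    ... | inj₂ (_ , emb) = ⊥-elim (noCopath (Embeds⇒ContainsInduced G (complement (path (suc m)))
            (Embeds-complement G (path (suc m)) emb)))

-- Polynomial cliques and stable sets

record RamseyPair (G : Graph (Fin n)) (S : Subset n) (b : ℕ) : Set where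
  field
    K I    : Subset n
    K⊆S    : K ⊆ S
    I⊆S    : I ⊆ S
    clique : Clique G K
    stable : Stable G I
    large  : b ≤ ∣ K ∣ * ∣ I ∣

singletonRamsey : (G : Graph (Fin n)) (S : Subset n) {x : Fin n} → x ∈ S → RamseyPair G S 1
singletonRamsey G S {x} x∈S = record
  { K = ⁅ x ⁆ ; I = ⁅ x ⁆ ; K⊆S = sub ; I⊆S = sub
  ; clique = λ u∈ v∈ u≢v → contradiction (trans (x∈⁅y⁆⇒x≡y x u∈) (sym (x∈⁅y⁆⇒x≡y x v∈))) u≢v
  ; stable = λ u∈ v∈ → Graph.adj-irrefl G (trans (x∈⁅y⁆⇒x≡y x u∈) (sym (x∈⁅y⁆⇒x≡y x v∈)))
  ; large = ≤-reflexive (sym (cong₂ _*_ (∣⁅x⁆∣≡1 x) (∣⁅x⁆∣≡1 x))) }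
  where
  sub : ⁅ x ⁆ ⊆ S
  sub z∈ = subst (_∈ S) (sym (x∈⁅y⁆⇒x≡y x z∈)) x∈S

larger : {P : Subset n → Set} (p q : Subset n) → P p → P q →
  ∃[ r ] P r × ∣ p ∣ ≤ ∣ r ∣ × ∣ q ∣ ≤ ∣ r ∣
larger p q Pp Pq with ≤-total ∣ p ∣ ∣ q ∣
... | inj₁ p≤q = q , Pq , p≤q , ≤-refl
... | inj₂ q≤p = p , Pp , ≤-refl , q≤p

doubleProduct : ∀ {b k₁ k₂ i₁ i₂ i} → b ≤ k₁ * i₁ → b ≤ k₂ * i₂ → i₁ ≤ i → i₂ ≤ i →
  2 * b ≤ (k₁ + k₂) * i
doubleProduct {b} {k₁} {k₂} {i₁} {i₂} {i} b≤₁ b≤₂ i₁≤i i₂≤i = begin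
  2 * b                ≡⟨ cong (_+_ b) (+-identityʳ b) ⟩
  b + b                ≤⟨ +-mono-≤ b≤₁ b≤₂ ⟩
  k₁ * i₁ + k₂ * i₂    ≤⟨ +-mono-≤ (*-monoʳ-≤ k₁ i₁≤i) (*-monoʳ-≤ k₂ i₂≤i) ⟩
  k₁ * i + k₂ * i      ≡⟨ *-distribʳ-+ i k₁ k₂ ⟨
  (k₁ + k₂) * i        ∎
  where open ≤-Reasoning

-- Over a complete pair the cliques are united and the larger stable set is kept; over an
-- anticomplete pair the roles are exchanged. The new product is at least the sum of the two old
-- ones.
combineRamsey : {G : Graph (Fin n)} {W : Subset n} {D b : ℕ} (P : PurePair G W D) →
  RamseyPair G (PurePair.X P) b → RamseyPair G (PurePair.Y P) b → RamseyPair G W (2 * b)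
combineRamsey {n} {G} {W} {b = b} P R₁ R₂ = combine pure
  where
  open PurePair P
  module R₁ = RamseyPair R₁
  module R₂ = RamseyPair R₂
  ∪⊆W : ∀ {p q} → p ⊆ X → q ⊆ Y → p ∪ q ⊆ W
  ∪⊆W {p} {q} p⊆X q⊆Y x∈ = [ X⊆W ∘ p⊆X , Y⊆W ∘ q⊆Y ]′ (x∈p∪q⁻ p q x∈)
  ∣∪∣ : ∀ p q → p ⊆ X → q ⊆ Y → ∣ p ∪ q ∣ ≡ ∣ p ∣ + ∣ q ∣
  ∣∪∣ p q p⊆X q⊆Y = ∣p∪q∣≡∣p∣+∣q∣ p q λ x∈p x∈q → X#Y (p⊆X x∈p) (q⊆Y x∈q)
  combine : Complete G X Y ⊎ Anticomplete G X Y → RamseyPair G W (2 * b)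
  combine (inj₁ comp) with larger {P = λ p → p ⊆ W × Stable G p} R₁.I R₂.I
                             (X⊆W ∘ R₁.I⊆S , R₁.stable) (Y⊆W ∘ R₂.I⊆S , R₂.stable)
  ... | I , (I⊆W , stable) , I₁≤I , I₂≤I = record
    { K = R₁.K ∪ R₂.K ; I = I ; K⊆S = ∪⊆W R₁.K⊆S R₂.K⊆S ; I⊆S = I⊆W
    ; clique = λ u∈ v∈ → clique (x∈p∪q⁻ R₁.K R₂.K u∈) (x∈p∪q⁻ R₁.K R₂.K v∈)
    ; stable = stable
    ; large = subst (λ k → 2 * b ≤ k * ∣ I ∣) (sym (∣∪∣ R₁.K R₂.K R₁.K⊆S R₂.K⊆S))
                (doubleProduct {k₁ = ∣ R₁.K ∣} {∣ R₂.K ∣} R₁.large R₂.large I₁≤I I₂≤I) }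
    where
    clique : ∀ {u v} → u ∈ R₁.K ⊎ u ∈ R₂.K → v ∈ R₁.K ⊎ v ∈ R₂.K → u ≢ v → Adj G u v
    clique (inj₁ u∈) (inj₁ v∈) = R₁.clique u∈ v∈
    clique (inj₂ u∈) (inj₂ v∈) = R₂.clique u∈ v∈
    clique (inj₁ u∈) (inj₂ v∈) _ = comp (R₁.K⊆S u∈) (R₂.K⊆S v∈)
    clique (inj₂ u∈) (inj₁ v∈) _ = Graph.adj-sym G (comp (R₁.K⊆S v∈) (R₂.K⊆S u∈))
  combine (inj₂ anti) with larger {P = λ p → p ⊆ W × Clique G p} R₁.K R₂.K
                             (X⊆W ∘ R₁.K⊆S , R₁.clique) (Y⊆W ∘ R₂.K⊆S , R₂.clique)
  ... | K , (K⊆W , clique) , K₁≤K , K₂≤K = record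
    { K = K ; I = R₁.I ∪ R₂.I ; K⊆S = K⊆W ; I⊆S = ∪⊆W R₁.I⊆S R₂.I⊆S
    ; clique = clique
    ; stable = λ u∈ v∈ → stable (x∈p∪q⁻ R₁.I R₂.I u∈) (x∈p∪q⁻ R₁.I R₂.I v∈)
    ; large = subst (2 * b ≤_)
                (trans (cong (_* ∣ K ∣) (sym (∣∪∣ R₁.I R₂.I R₁.I⊆S R₂.I⊆S))) (*-comm _ ∣ K ∣))
                (doubleProduct {k₁ = ∣ R₁.I ∣} {∣ R₂.I ∣}
                  (≤-trans R₁.large (≤-reflexive (*-comm ∣ R₁.K ∣ _)))
                  (≤-trans R₂.large (≤-reflexive (*-comm ∣ R₂.K ∣ _))) K₁≤K K₂≤K) }
    where
    stable : ∀ {u v} → u ∈ R₁.I ⊎ u ∈ R₂.I → v ∈ R₁.I ⊎ v ∈ R₂.I → ¬ Adj G u v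
    stable (inj₁ u∈) (inj₁ v∈) = R₁.stable u∈ v∈
    stable (inj₂ u∈) (inj₂ v∈) = R₂.stable u∈ v∈
    stable (inj₁ u∈) (inj₂ v∈) = anti (R₁.I⊆S u∈) (R₂.I⊆S v∈)
    stable (inj₂ u∈) (inj₁ v∈) uv = anti (R₁.I⊆S v∈) (R₂.I⊆S u∈) (Graph.adj-sym G uv)

-- Each pure pair divides the size by at most `D` and doubles the product. After `j` rounds at least
-- two vertices remain, so one more round is possible and ends in nonempty sets; this gives the
-- exponent `suc j`.
purePairs⇒ramseyPair : (G : Graph (Fin n)) (D : ℕ) .{{_ : NonZero D}} →
  (∀ W → 2 ≤ ∣ W ∣ → PurePair G W D) → ∀ j S → 2 * D ^ j ≤ ∣ S ∣ → RamseyPair G S (2 ^ suc j)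
purePairs⇒ramseyPair G D pair j S large =
  combineRamsey P (half j X large ∣X∣≥) (half j Y large ∣Y∣≥)
  where
  P : PurePair G S D
  P = pair S (≤-trans (*-monoʳ-≤ 2 (m^n>0 D j)) large)
  open PurePair P
  half : ∀ j Z → 2 * D ^ j ≤ ∣ S ∣ → ∣ S ∣ ≤ D * ∣ Z ∣ → RamseyPair G Z (2 ^ j)
  half zero Z large S≤ = singletonRamsey G Z (proj₂ (nonempty-of-pos Z (pos ∣ Z ∣ (≤-trans large S≤))))
    where
    pos : ∀ z → 2 ≤ D * z → 1 ≤ z
    pos zero    h = contradiction (subst (2 ≤_) (*-zeroʳ D) h) λ ()
    pos (suc z) h = s≤s z≤n
  half (suc j) Z large S≤ = purePairs⇒ramseyPair G D pair j Z (*-cancelˡ-≤ D (begin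
    D * (2 * D ^ j)    ≡⟨ regroup D (D ^ j) ⟩
    2 * D ^ suc j      ≤⟨ large ⟩
    ∣ S ∣              ≤⟨ S≤ ⟩
    D * ∣ Z ∣          ∎))
    where
    open ≤-Reasoning
    regroup : ∀ D x → D * (2 * x) ≡ 2 * (D * x)
    regroup = solve-∀

n<2^n : ∀ n → n < 2 ^ n
n<2^n zero    = s≤s z≤n
n<2^n (suc n) = begin-strict
  suc n              <⟨ +-mono-<-≤ (n<1+n 0) ≤-refl ⟩
  2 + n              ≤⟨ +-mono-≤ {1} {2 ^ n} (m^n>0 2 n) (n<2^n n) ⟩
  2 ^ n + 2 ^ n      ≡⟨ cong (_+_ (2 ^ n)) (+-identityʳ (2 ^ n)) ⟨
  2 ^ suc n          ∎
  where open ≤-Reasoning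

-- For `g` exponential this is a discrete logarithm of `n`, found by searching downwards from an
-- index where `g` exceeds `n`.
bracket : (g : ℕ → ℕ) (n : ℕ) → g 0 ≤ n → ∀ j → n < g j → ∃[ i ] g i ≤ n × n < g (suc i)
bracket g n g0≤n zero    n<g0 = contradiction g0≤n (<⇒≱ n<g0)
bracket g n g0≤n (suc j) n<g  with g j ≤? n
... | yes gj≤n = j , gj≤n , n<g
... | no  gj≰n = bracket g n g0≤n j (≰⇒> gj≰n)

cliqueOrStable : (G : Graph (Fin n)) (d : ℕ) → (∀ W → 2 ≤ ∣ W ∣ → PurePair G W (2 + d)) →
  ∃[ S ] (Clique G S ⊎ Stable G S) × n ≤ ∣ S ∣ ^ (2 * (3 + d))
-- The bracket starts from `2 * D ^ 0 ≤ n`, so the graphs with fewer than two vertices are settled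
-- separately.
cliqueOrStable {zero}     G d pair = ⊥ , inj₁ (λ u∈ → ⊥-elim (∉⊥ u∈)) , z≤n
cliqueOrStable {suc zero} G d pair = ⊤ , inj₁ (λ { {zero} {zero} _ _ u≢v → contradiction refl u≢v }) ,
  ≤-reflexive (sym (^-zeroˡ (2 * (3 + d))))
cliqueOrStable {n@(suc (suc _))} G d pair
  with bracket (λ j → 2 * D ^ j) n (s≤s (s≤s z≤n)) n
         (<-≤-trans (n<2^n n) (≤-trans (^-monoˡ-≤ n (s≤s (s≤s z≤n))) (m≤m+n (D ^ n) _)))
  where
  D : ℕ
  D = 2 + d
... | j , lower , upper with purePairs⇒ramseyPair G (2 + d) pair j ⊤ (subst (2 * (2 + d) ^ j ≤_) (sym (∣⊤∣≡n n)) lower)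
... | R with larger {P = λ p → Clique G p ⊎ Stable G p} (RamseyPair.K R) (RamseyPair.I R)
               (inj₁ (RamseyPair.clique R)) (inj₂ (RamseyPair.stable R))
... | S , hom , K≤S , I≤S = S , hom , (begin
  n                              ≤⟨ <⇒≤ upper ⟩
  -- Bounding `D` by `2 ^ D` replaces a logarithm of `D` by `D` itself, at the cost of a smaller
  -- exponent.
  2 * D ^ suc j                  ≤⟨ *-monoʳ-≤ 2 (^-monoˡ-≤ (suc j) (<⇒≤ (n<2^n D))) ⟩
  2 * (2 ^ D) ^ suc j            ≡⟨ cong (2 *_) (^-*-assoc 2 D (suc j)) ⟩
  -- Adding `j` to the exponent makes it a multiple of `suc j`, so that the lower bound `2 ^ suc j`
  -- on the product can be substituted.
  2 ^ (1 + D * suc j)            ≤⟨ ^-monoʳ-≤ 2 (m≤n+m (1 + D * suc j) j) ⟩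
  2 ^ (j + (1 + D * suc j))      ≡⟨ cong (2 ^_) (regroup D j) ⟩
  2 ^ (suc j * suc D)            ≡⟨ ^-*-assoc 2 (suc j) (suc D) ⟨
  (2 ^ suc j) ^ suc D            ≤⟨ ^-monoˡ-≤ (suc D) R.large ⟩
  (∣ R.K ∣ * ∣ R.I ∣) ^ suc D    ≤⟨ ^-monoˡ-≤ (suc D) (*-mono-≤ K≤S I≤S) ⟩
  (∣ S ∣ * ∣ S ∣) ^ suc D        ≡⟨ cong (λ s → (∣ S ∣ * s) ^ suc D) (*-identityʳ ∣ S ∣) ⟨
  (∣ S ∣ ^ 2) ^ suc D            ≡⟨ ^-*-assoc ∣ S ∣ 2 (suc D) ⟩
  ∣ S ∣ ^ (2 * suc D)            ∎)
  where
  open ≤-Reasoning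
  module R = RamseyPair R
  D : ℕ
  D = 2 + d
  regroup : ∀ D j → j + (1 + D * suc j) ≡ suc j * suc D
  regroup = solve-∀

-- Rational constants and conclusion

-- Built with mkℚ rather than _/_ so that its numerator and denominator compute.
unitFraction : ℕ → ℚ
unitFraction d = mkℚ (ℤ.+ 1) d (1-coprimeTo (suc d))

0<unitFraction : ∀ d → 0ℚ ℚ.< unitFraction d
0<unitFraction d = ℚ.positive⁻¹ (unitFraction d)

-- The comparison is moved to unnormalised rationals, where the product computes and the order is
-- cross multiplication.
unitFraction-*-≤ : ∀ d n x → n ≤ suc d * x → unitFraction d ℚ.* fromℕ n ℚ.≤ fromℕ x
unitFraction-*-≤ d n x n≤ = ℚ.toℚᵘ-cancel-≤ (begin
  toℚᵘ (unitFraction d ℚ.* fromℕ n)         ≃⟨ ℚ.toℚᵘ-homo-* (unitFraction d) (fromℕ n) ⟩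
  mkℚᵘ (ℤ.+ 1) d ℚᵘ.* toℚᵘ (fromℕ n)          ≃⟨ ℚᵘ.*-congˡ {mkℚᵘ (ℤ.+ 1) d} (ℚ.toℚᵘ-fromℚᵘ (mkℚᵘ (ℤ.+ n) 0)) ⟩
  mkℚᵘ (ℤ.+ 1) d ℚᵘ.* mkℚᵘ (ℤ.+ n) 0            ≤⟨ ℚᵘ.*≤* cross ⟩
  mkℚᵘ (ℤ.+ x) 0                              ≃⟨ ℚ.toℚᵘ-fromℚᵘ (mkℚᵘ (ℤ.+ x) 0) ⟨
  toℚᵘ (fromℕ x)                            ∎)
  where
  open ℚᵘ.≤-Reasoning
  cross : (ℤ.+ 1 ℤ.* ℤ.+ n) ℤ.* ℤ.+ 1 ℤ.≤ ℤ.+ x ℤ.* ℤ.+ (suc d * 1)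
  cross = subst₂ ℤ._≤_
    (sym (trans (ℤ.*-identityʳ (ℤ.+ 1 ℤ.* ℤ.+ n)) (ℤ.*-identityˡ (ℤ.+ n))))
    (trans (cong ℤ.+_ (trans (*-comm (suc d) x) (cong (x *_) (sym (*-identityʳ (suc d)))))) (ℤ.pos-* x (suc d * 1)))
    (ℤ.+≤+ n≤)

linearPurePair : ∀ k → 1 ≤ k → ∃[ c ] 0ℚ ℚ.< c ×
  (∀ n → 2 ≤ n → (G : Graph (Fin n)) →
    ¬ ContainsInduced G (path k) → ¬ ContainsInduced G (complement (path k)) →
    ∃[ X ] ∃[ Y ] Disjoint X Y × c ℚ.* fromℕ n ℚ.≤ fromℕ ∣ X ∣ × c ℚ.* fromℕ n ℚ.≤ fromℕ ∣ Y ∣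
      × (Complete G X Y ⊎ Anticomplete G X Y))
linearPurePair (suc m) _ with strongErdosHajnal m
-- The argument of `unitFraction` is the denominator minus one, so `c` is `1 / (2 + d)`.
... | d , strong = unitFraction (1 + d) , 0<unitFraction (1 + d) , λ n 2≤n G noPath noCopath →
  let open PurePair (strong {n} G noPath noCopath (⊤ {n}) (subst (2 ≤_) (sym (∣⊤∣≡n n)) 2≤n))
  in X , Y , #⇒Disjoint {p = X} {Y} X#Y ,
     unitFraction-*-≤ (1 + d) n (∣ X ∣) (subst (_≤ (2 + d) * ∣ X ∣) (∣⊤∣≡n n) ∣X∣≥) ,
     unitFraction-*-≤ (1 + d) n (∣ Y ∣) (subst (_≤ (2 + d) * ∣ Y ∣) (∣⊤∣≡n n) ∣Y∣≥) , pure

polynomialHomogeneousSet : ∀ k → 1 ≤ k → ∃[ c ] 0ℚ ℚ.< c ×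
  (∀ n (G : Graph (Fin n)) →
    ¬ ContainsInduced G (path k) → ¬ ContainsInduced G (complement (path k)) →
    ∃[ S ] (Clique G S ⊎ Stable G S) × Power≤ n c ∣ S ∣)
polynomialHomogeneousSet (suc m) _ with strongErdosHajnal m
-- The exponent is `1 / (2 * (3 + d))`. Its numerator is 1, so `Power≤` compares `n ^ 1` with the
-- power bounded in `cliqueOrStable`.
... | d , strong = unitFraction (pred (2 * (3 + d))) , 0<unitFraction (pred (2 * (3 + d))) ,
  λ n G noPath noCopath →
    let S , hom , n≤ = cliqueOrStable G d (strong G noPath noCopath)
    in S , hom , ≤-trans (≤-reflexive (*-identityʳ n)) n≤

theorem4 : (∀ (k : ℕ) → 1 ≤ k →
    ∃[ c ] 0ℚ ℚ.< c ×
    (∀ (n : ℕ) → 2 ≤ n → (G : Graph (Fin n)) →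
    ¬ ContainsInduced G (path k) →
    ¬ ContainsInduced G (complement (path k)) →
    ∃[ X ] ∃[ Y ] Disjoint X Y
    × c ℚ.* fromℕ n ℚ.≤ fromℕ ∣ X ∣
    × c ℚ.* fromℕ n ℚ.≤ fromℕ ∣ Y ∣
    × (Complete G X Y ⊎ Anticomplete G X Y)))
    ×
    (∀ (k : ℕ) → 1 ≤ k →
    ∃[ c′ ] 0ℚ ℚ.< c′ ×
    (∀ (n : ℕ) (G : Graph (Fin n)) →
    ¬ ContainsInduced G (path k) →
    ¬ ContainsInduced G (complement (path k)) →
    ∃[ S ] (Clique G S ⊎ Stable G S) × Power≤ n c′ ∣ S ∣))
theorem4 = linearPurePair , polynomialHomogeneousSet
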